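{- Let $G$ be a finite graph with at least one vertex. Then the limit $$F(G)=\lim_{k\to\infty}\frac{\log \alpha(G[k])}{\log k}$$ exists and $F(G)=\alpha(G)-1$.
   Context: Graphs are finite, simple and undirected; $\alpha(\cdot)$ denotes the independence number (the maximum size of a set of pairwise non-adjacent vertices). For a finite graph $G$ with vertex set $V$ and $k\in\mathbb{N}$, the graph $G[k]$ is defined as follows. Its vertices are the configurations of $k$ identical pebbles on the vertices of $G$, i.e. the functions $f:V\to\mathbb{Z}_{\geq 0}$ with $\sum_{v\in V} f(v)=k$. Two distinct configurations $f$ and $g$ are adjacent in $G[k]$ if $g$ can be obtained from $f$ by (simultaneously) moving some of the pebbles, each moved pebble going to a neighbour in $G$ of the vertex it lies on; that is, if there are maps $\varphi,\gamma:\{1,\dots,k\}\to V$ with $|\varphi^{ -1}(v)|=f(v)$ and $|\gamma^{ -1}(v)|=g(v)$ for all $v\in V$, such that for every $i$ either $\varphi(i)=\gamma(i)$ or $\varphi(i)$ and $\gamma(i)$ are adjacent in $G$. (Equivalently, $G[k]$ is the quotient of the $k$-fold strong power $G^{\boxtimes k}$ by the action of the symmetric group $S_k$ permuting coordinates.) -}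

module Defs where

open import Data.Fin.Base using (Fin; zero; suc; finToFun; funToFin)
import Data.Fin.Properties as Fin
open import Data.Fin.Subset using (Subset; _∈_; ∣_∣; ⊥)
import Data.Fin.Subset.Properties as Subset
open import Data.Integer.Base using (+_)
import Data.Integer.Base as ℤ
import Data.Integer.Properties as ℤ
open import Data.Nat.Base using (ℕ; zero; suc; pred; s≤s; z≤n; NonTrivial; nonTrivial⇒n>1)
import Data.Nat.Base as ℕ
import Data.Nat.Properties as ℕ
import Data.Nat.Coprimality as Coprime
open import Data.Product.Base using (∃; _×_; _,_; proj₁; proj₂)
open import Data.Rational.Base
  using (ℚ; mkℚ; 0ℚ; 1ℚ; ½; _+_; _*_; _-_; -_; _/_; 1/_; _≤_; _<_; *≤*; *<*;
         nonNegative; positive; toℚᵘ)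
import Data.Rational.Base as ℚ
import Data.Rational.Properties as ℚ
import Data.Rational.Unnormalised.Base as ℚᵘ
import Data.Rational.Unnormalised.Properties as ℚᵘ
open import Data.Rational.Solver using (module +-*-Solver)
open import Data.Sum.Base using (_⊎_; inj₁; inj₂)
open import Data.Sum.Function.Propositional using (_⊎-↔_)
open import Data.Vec.Base using (Vec; []; _∷_; lookup; tabulate; sum)
open import Data.Vec.Properties using (tabulate-cong)
open import Function.Base using (_∘_)
open import Function.Bundles using (_↔_; mk↔ₛ′; Inverse)
open import Function.Properties.Inverse using (↔-trans; ↔-sym; ↔⇒↣)
open import Relation.Binary.Definitions using (Decidable; DecidableEquality)
open import Relation.Binary.PropositionalEquality
open import Relation.Nullary.Decidable
  using (Dec; yes; no; does; map′; via-injection; ¬?; _×-dec_; _⊎-dec_; _→-dec_)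
open import Relation.Nullary.Negation using (¬_; contradiction)

-- Finiteness is witnessed by a bijection with Fin order, and adjacency is
-- decidable, as it is classically for every finite graph.
record FiniteGraph : Set₁ where
  field
    Vertex     : Set
    order      : ℕ
    numbering  : Fin order ↔ Vertex
    Adj        : Vertex → Vertex → Set
    Adj?       : Decidable Adj
    Adj-sym    : ∀ {u v} → Adj u v → Adj v u
    Adj-irrefl : ∀ {v} → ¬ Adj v v

  vertex : Fin order → Vertex
  vertex = Inverse.to numbering

  index : Vertex → Fin order
  index = Inverse.from numbering

  _≟_ : DecidableEquality Vertex
  _≟_ = via-injection (↔⇒↣ (↔-sym numbering)) Fin._≟_

  Independent : Subset order → Set
  Independent S = ∀ i j → i ∈ S → j ∈ S → ¬ Adj (vertex i) (vertex j)

  IsIndependenceNumber : ℕ → Set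
  IsIndependenceNumber a =
    (∃ λ S → Independent S × ∣ S ∣ ≡ a) × (∀ S → Independent S → ∣ S ∣ ℕ.≤ a)

  private
    Independent? : ∀ S → Dec (Independent S)
    Independent? S = Fin.all? λ i → Fin.all? λ j →
      (i Subset.∈? S) →-dec ((j Subset.∈? S) →-dec ¬? (Adj? (vertex i) (vertex j)))

    search : ∀ b → (∀ S → Independent S → ∣ S ∣ ℕ.≤ b) → ∃ IsIndependenceNumber
    search b bound
      with Subset.anySubset? (λ S → Independent? S ×-dec (∣ S ∣ ℕ.≟ b))
    ... | yes found = b , found , bound
    search zero bound | no none =
      contradiction (⊥ , (λ i j i∈⊥ → contradiction i∈⊥ Subset.∉⊥) , Subset.∣⊥∣≡0 order) none
    search (suc b) bound | no none = search b λ S ind →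
      ℕ.≤-pred (ℕ.≤∧≢⇒< (bound S ind) λ eq → none (S , ind , eq))

  independenceNumber : ∃ IsIndependenceNumber
  independenceNumber = search order λ S _ → Subset.∣p∣≤n S

open FiniteGraph using (Vertex)

α : FiniteGraph → ℕ
α G = proj₁ (FiniteGraph.independenceNumber G)

Configuration : ℕ → ℕ → Set
Configuration n k = ∃ λ (f : Vec ℕ n) → sum f ≡ k

Configuration-≡ : ∀ {n k} {f g : Configuration n k} → proj₁ f ≡ proj₁ g → f ≡ g
Configuration-≡ {f = f , p} {g = .f , q} refl = cong (f ,_) (ℕ.≡-irrelevant p q)

#Configurations : ℕ → ℕ → ℕ
#Configurations zero    zero    = 1
#Configurations zero    (suc k) = 0
#Configurations (suc n) zero    = #Configurations n zero
#Configurations (suc n) (suc k) = #Configurations n (suc k) ℕ.+ #Configurations (suc n) k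

Configuration-numbering : ∀ n k → Fin (#Configurations n k) ↔ Configuration n k
Configuration-numbering zero zero = mk↔ₛ′ (λ _ → [] , refl) (λ _ → zero)
  (λ { ([] , _) → Configuration-≡ refl }) (λ { zero → refl })
Configuration-numbering zero (suc k) = mk↔ₛ′ (λ ()) (λ { ([] , ()) }) (λ { ([] , ()) }) (λ ())
Configuration-numbering (suc n) zero = ↔-trans (Configuration-numbering n zero)
  (mk↔ₛ′ {B = Configuration (suc n) zero}
    (λ (f , p) → 0 ∷ f , p)
    (λ { (zero ∷ f , p) → f , p ; (suc _ ∷ _ , ()) })
    (λ { (zero ∷ f , p) → refl ; (suc _ ∷ _ , ()) })
    (λ _ → refl))
Configuration-numbering (suc n) (suc k) = ↔-trans Fin.+↔⊎ (↔-trans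
  (Configuration-numbering n (suc k) ⊎-↔ Configuration-numbering (suc n) k)
  (mk↔ₛ′
    (λ { (inj₁ (f , p)) → 0 ∷ f , p ; (inj₂ (a ∷ f , p)) → suc a ∷ f , cong suc p })
    (λ { (zero ∷ f , p) → inj₁ (f , p) ; (suc a ∷ f , p) → inj₂ (a ∷ f , ℕ.suc-injective p) })
    (λ { (zero ∷ f , p) → refl ; (suc a ∷ f , p) → Configuration-≡ refl })
    (λ { (inj₁ _) → refl ; (inj₂ (a ∷ f , p)) → cong inj₂ (Configuration-≡ refl) })))

module Pebbles (G : FiniteGraph) (k : ℕ) where
  open FiniteGraph G using (order; numbering; Adj; Adj?; Adj-sym; vertex; index; _≟_)

  pebblesAt : Configuration order k → Vertex G → ℕ
  pebblesAt (f , _) v = lookup f (index v)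

  preimage : (Fin k → Vertex G) → Vertex G → Subset k
  preimage φ v = tabulate λ i → does (φ i ≟ v)

  Places : (Fin k → Vertex G) → Configuration order k → Set
  Places φ f = ∀ v → ∣ preimage φ v ∣ ≡ pebblesAt f v

  Steps : (φ γ : Fin k → Vertex G) → Set
  Steps φ γ = ∀ i → φ i ≡ γ i ⊎ Adj (φ i) (γ i)

  Move : Configuration order k → Configuration order k → Set
  Move f g = ∃ λ φ → ∃ λ γ → Places φ f × Places γ g × Steps φ γ

  private
    _≟ᶜ_ : DecidableEquality (Configuration order k)
    _≟ᶜ_ = via-injection (↔⇒↣ (↔-sym (Configuration-numbering order k))) Fin._≟_

    allVertices? : {P : Vertex G → Set} → (∀ v → Dec (P v)) → Dec (∀ v → P v)
    allVertices? {P} P? = map′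
      (λ all v → subst P (Inverse.inverseˡ numbering refl) (all (index v)))
      (λ all i → all (vertex i))
      (Fin.all? (P? ∘ vertex))

    anyPlacement? : {P : (Fin k → Vertex G) → Set} →
                    (∀ {φ ψ} → φ ≗ ψ → P φ → P ψ) →
                    (∀ φ → Dec (P φ)) → Dec (∃ P)
    anyPlacement? {P} resp P? = map′
      (λ (c , p) → vertex ∘ finToFun c , p)
      (λ (φ , p) → funToFin (index ∘ φ) , resp (φ≗ φ) p)
      (Fin.any? (λ c → P? (vertex ∘ finToFun c)))
      where
      φ≗ : ∀ φ i → φ i ≡ vertex (finToFun (funToFin (index ∘ φ)) i)
      φ≗ φ i = sym (trans (cong vertex (Fin.finToFun-funToFin (index ∘ φ) i))
                          (Inverse.inverseˡ numbering refl))

    Places-resp : ∀ {φ ψ} f → φ ≗ ψ → Places φ f → Places ψ f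
    Places-resp f φ≗ψ p v =
      trans (cong ∣_∣ (tabulate-cong λ i → cong (λ w → does (w ≟ v)) (sym (φ≗ψ i)))) (p v)

    Places? : ∀ φ f → Dec (Places φ f)
    Places? φ f = allVertices? λ v → ∣ preimage φ v ∣ ℕ.≟ pebblesAt f v

    Steps? : ∀ φ γ → Dec (Steps φ γ)
    Steps? φ γ = Fin.all? λ i → (φ i ≟ γ i) ⊎-dec Adj? (φ i) (γ i)

    step : ∀ {u u′ v v′} → u ≡ u′ → v ≡ v′ → u ≡ v ⊎ Adj u v → u′ ≡ v′ ⊎ Adj u′ v′
    step refl refl s = s

    flip-step : ∀ {u v} → u ≡ v ⊎ Adj u v → v ≡ u ⊎ Adj v u
    flip-step (inj₁ u≡v) = inj₁ (sym u≡v)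
    flip-step (inj₂ u~v) = inj₂ (Adj-sym u~v)

    Move? : Decidable Move
    Move? f g = anyPlacement?
      (λ φ≗ψ (γ , p , q , s) →
         γ , Places-resp f φ≗ψ p , q , λ i → step (φ≗ψ i) refl (s i))
      (λ φ → anyPlacement?
        (λ γ≗δ (p , q , s) → p , Places-resp g γ≗δ q , λ i → step refl (γ≗δ i) (s i))
        (λ γ → Places? φ f ×-dec (Places? γ g ×-dec Steps? φ γ)))

    Move-sym : ∀ f g → Move f g → Move g f
    Move-sym f g (φ , γ , p , q , s) = γ , φ , q , p , flip-step ∘ s

  graph : FiniteGraph
  graph = record
    { Vertex     = Configuration order k
    ; order      = #Configurations order k
    ; numbering  = Configuration-numbering order k
    ; Adj        = λ f g → f ≢ g × Move f g
    ; Adj?       = λ f g → ¬? (f ≟ᶜ g) ×-dec Move? f g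
    ; Adj-sym    = λ {f} {g} (f≢g , m) → f≢g ∘ sym , Move-sym f g m
    ; Adj-irrefl = λ (f≢f , _) → f≢f refl
    }

infix 8 _[_]
_[_] : FiniteGraph → ℕ → FiniteGraph
G [ k ] = Pebbles.graph G k

open ℚ.≤-Reasoning
open +-*-Solver using (solve; _:=_; _:+_; _:*_; _:-_; :-_; con)

module RationalLemmas where
  half-pos : ∀ {ε} → 0ℚ < ε → 0ℚ < ½ * ε
  half-pos {ε} 0<ε = ℚ.positive⁻¹ (½ * ε) {{ℚ.pos*pos⇒pos ½ ε {{positive 0<ε}}}}

  halves : ∀ ε → ½ * ε + ½ * ε ≡ ε
  halves = solve 1 (λ ε → con ½ :* ε :+ con ½ :* ε := ε) refl

  *-pos : ∀ {p q} → 0ℚ < p → 0ℚ < q → 0ℚ < p * q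
  *-pos {p} {q} 0<p 0<q =
    ℚ.positive⁻¹ (p * q) {{ℚ.pos*pos⇒pos p {{positive 0<p}} q {{positive 0<q}}}}

  *-mono-≤ : ∀ {p q r s} → 0ℚ ≤ p → 0ℚ ≤ s → p ≤ q → r ≤ s → p * r ≤ q * s
  *-mono-≤ {p} {q} {r} {s} 0≤p 0≤s p≤q r≤s = ℚ.≤-trans
    (ℚ.*-monoˡ-≤-nonNeg p {{nonNegative 0≤p}} r≤s)
    (ℚ.*-monoʳ-≤-nonNeg s {{nonNegative 0≤s}} p≤q)

  ∣∣-≤ : ∀ {p q} → p ≤ q → - p ≤ q → ℚ.∣ p ∣ ≤ q
  ∣∣-≤ {p} p≤q -p≤q with ℚ.∣p∣≡p∨∣p∣≡-p p
  ... | inj₁ eq rewrite eq = p≤q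
  ... | inj₂ eq rewrite eq = -p≤q

  ∣-∣-sym : ∀ p q → ℚ.∣ p - q ∣ ≡ ℚ.∣ q - p ∣
  ∣-∣-sym p q = trans (sym (ℚ.∣-p∣≡∣p∣ (p - q)))
    (cong ℚ.∣_∣ (solve 2 (λ p q → :- (p :- q) := q :- p) refl p q))

  ∣∣-triangle : ∀ p q → ℚ.∣ p ∣ ≤ ℚ.∣ p - q ∣ + ℚ.∣ q ∣
  ∣∣-triangle p q = subst (λ r → ℚ.∣ r ∣ ≤ ℚ.∣ p - q ∣ + ℚ.∣ q ∣)
    (solve 2 (λ p q → (p :- q) :+ q := p) refl p q) (ℚ.∣p+q∣≤∣p∣+∣q∣ (p - q) q)

  shift : ∀ {p q r} → p ≤ q + r → p - r ≤ q
  shift {p} {q} {r} h = begin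
    p - r        ≤⟨ ℚ.+-monoˡ-≤ (- r) h ⟩
    q + r - r    ≡⟨ solve 2 (λ q r → q :+ r :- r := q) refl q r ⟩
    q            ∎

  ∣∣-lipschitz : ∀ p q → ℚ.∣ ℚ.∣ p ∣ - ℚ.∣ q ∣ ∣ ≤ ℚ.∣ p - q ∣
  ∣∣-lipschitz p q = ∣∣-≤ (shift (∣∣-triangle p q)) (begin
    - (ℚ.∣ p ∣ - ℚ.∣ q ∣)  ≡⟨ solve 2 (λ a b → :- (a :- b) := b :- a) refl ℚ.∣ p ∣ ℚ.∣ q ∣ ⟩
    ℚ.∣ q ∣ - ℚ.∣ p ∣      ≤⟨ shift (∣∣-triangle q p) ⟩
    ℚ.∣ q - p ∣            ≡⟨ ∣-∣-sym q p ⟩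
    ℚ.∣ p - q ∣            ∎)

open RationalLemmas

-- Total inverse: recip 0ℚ is junk, met by _/ℝ_ at finitely many indices only.
recip : ℚ → ℚ
recip p with p ℚ.≟ 0ℚ
... | yes _   = 0ℚ
... | no  p≢0 = 1/_ p {{ℚ.≢-nonZero p≢0}}

module RecipLemmas where
  recip-inverse : ∀ {p} → 0ℚ < p → p * recip p ≡ 1ℚ
  recip-inverse {p} 0<p with p ℚ.≟ 0ℚ
  ... | yes p≡0 = contradiction (sym p≡0) (ℚ.<⇒≢ 0<p)
  ... | no  p≢0 = ℚ.*-inverseʳ p {{ℚ.≢-nonZero p≢0}}

  recip-pos : ∀ {p} → 0ℚ < p → 0ℚ < recip p
  recip-pos {p} 0<p = ℚ.*-cancelˡ-<-nonNeg p {{nonNegative (ℚ.<⇒≤ 0<p)}} (begin-strict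
    p * 0ℚ       ≡⟨ ℚ.*-zeroʳ p ⟩
    0ℚ           <⟨ ℚ.positive⁻¹ 1ℚ ⟩
    1ℚ           ≡⟨ recip-inverse 0<p ⟨
    p * recip p  ∎)

open RecipLemmas

Cauchy : (ℕ → ℚ) → Set
Cauchy f = ∀ ε → 0ℚ < ε →
  ∃ λ N → ∀ m n → N ℕ.≤ m → N ℕ.≤ n → ℚ.∣ f m - f n ∣ < ε

record ℝ : Set where
  constructor mkℝ
  field
    seq    : ℕ → ℚ
    cauchy : Cauchy seq

open ℝ using (seq; cauchy)

-- Strict order by an eventual positive rational gap; for Cauchy sequences this
-- is invariant under equality of the reals they represent.
infix 4 _<ℝ_
record _<ℝ_ (x y : ℝ) : Set where
  constructor mk<
  field
    gap   : ℚ
    0<gap : 0ℚ < gap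
    from  : ℕ
    below : ∀ n → from ℕ.≤ n → seq x n + gap ≤ seq y n

fromℚ : ℚ → ℝ
fromℚ q = mkℝ (λ _ → q) λ ε 0<ε →
  0 , λ _ _ _ _ → subst (λ r → ℚ.∣ r ∣ < ε) (sym (ℚ.+-inverseʳ q)) 0<ε

0ℝ 1ℝ : ℝ
0ℝ = fromℚ 0ℚ
1ℝ = fromℚ 1ℚ

fromℕ : ℕ → ℝ
fromℕ n = fromℚ (+ n / 1)

infixl 6 _-ℝ_
_-ℝ_ : ℝ → ℝ → ℝ
x -ℝ y = mkℝ (λ n → seq x n - seq y n) λ ε 0<ε →
  let M , hx = cauchy x (½ * ε) (half-pos 0<ε)
      N , hy = cauchy y (½ * ε) (half-pos 0<ε)
  in M ℕ.⊔ N , λ m n l₁ l₂ →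
    let a = seq x m ; b = seq y m ; c = seq x n ; d = seq y n in begin-strict
      ℚ.∣ (a - b) - (c - d) ∣
        ≡⟨ cong ℚ.∣_∣ (solve 4 (λ a b c d → (a :- b) :- (c :- d) := (a :- c) :- (b :- d)) refl a b c d) ⟩
      ℚ.∣ (a - c) - (b - d) ∣
        ≤⟨ ℚ.∣p-q∣≤∣p∣+∣q∣ (a - c) (b - d) ⟩
      ℚ.∣ a - c ∣ + ℚ.∣ b - d ∣
        <⟨ ℚ.+-mono-< (hx m n (ℕ.m⊔n≤o⇒m≤o M N l₁) (ℕ.m⊔n≤o⇒m≤o M N l₂))
                      (hy m n (ℕ.m⊔n≤o⇒n≤o M N l₁) (ℕ.m⊔n≤o⇒n≤o M N l₂)) ⟩
      ½ * ε + ½ * ε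
        ≡⟨ halves ε ⟩
      ε ∎

∣_∣ℝ : ℝ → ℝ
∣ x ∣ℝ = mkℝ (λ n → ℚ.∣ seq x n ∣) λ ε 0<ε →
  let N , h = cauchy x ε 0<ε in
  N , λ m n l₁ l₂ → ℚ.≤-<-trans (∣∣-lipschitz (seq x m) (seq x n)) (h m n l₁ l₂)

module Boundedness where
  bounded : ∀ x → ∃ λ B → 0ℚ < B × ∃ λ N → ∀ n → N ℕ.≤ n → ℚ.∣ seq x n ∣ ≤ B
  bounded x =
    let N , h = cauchy x 1ℚ (ℚ.positive⁻¹ 1ℚ) in
    1ℚ + ℚ.∣ seq x N ∣ ,
    ℚ.+-mono-<-≤ (ℚ.positive⁻¹ 1ℚ) (ℚ.0≤∣p∣ (seq x N)) ,
    N , λ n l → ℚ.≤-trans (∣∣-triangle (seq x n) (seq x N))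
                  (ℚ.+-monoˡ-≤ ℚ.∣ seq x N ∣ (ℚ.<⇒≤ (h n N l ℕ.≤-refl)))

open Boundedness

infixl 7 _*ℝ_
_*ℝ_ : ℝ → ℝ → ℝ
x *ℝ y = mkℝ (λ n → seq x n * seq y n) λ ε 0<ε →
  let A , 0<A , K , hA = bounded x
      B , 0<B , L , hB = bounded y
      0<A+B = ℚ.+-mono-< 0<A 0<B
      δ = recip (A + B) * ε
      0<δ = *-pos (recip-pos 0<A+B) 0<ε
      M , hx = cauchy x δ 0<δ
      N , hy = cauchy y δ 0<δ
      P = (K ℕ.⊔ L) ℕ.⊔ (M ℕ.⊔ N)
  in P , λ m n l₁ l₂ →
    let a = seq x m ; b = seq y m ; c = seq x n ; d = seq y n
        K≤m = ℕ.m⊔n≤o⇒m≤o K L (ℕ.m⊔n≤o⇒m≤o (K ℕ.⊔ L) (M ℕ.⊔ N) l₁)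
        L≤n = ℕ.m⊔n≤o⇒n≤o K L (ℕ.m⊔n≤o⇒m≤o (K ℕ.⊔ L) (M ℕ.⊔ N) l₂)
        M⊔N≤m = ℕ.m⊔n≤o⇒n≤o (K ℕ.⊔ L) (M ℕ.⊔ N) l₁
        M⊔N≤n = ℕ.m⊔n≤o⇒n≤o (K ℕ.⊔ L) (M ℕ.⊔ N) l₂
        b-d<δ = hy m n (ℕ.m⊔n≤o⇒n≤o M N M⊔N≤m) (ℕ.m⊔n≤o⇒n≤o M N M⊔N≤n)
        a-c<δ = hx m n (ℕ.m⊔n≤o⇒m≤o M N M⊔N≤m) (ℕ.m⊔n≤o⇒m≤o M N M⊔N≤n)
    in begin-strict
      ℚ.∣ a * b - c * d ∣
        ≡⟨ cong ℚ.∣_∣ (solve 4 (λ a b c d → a :* b :- c :* d := a :* (b :- d) :+ d :* (a :- c)) refl a b c d) ⟩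
      ℚ.∣ a * (b - d) + d * (a - c) ∣
        ≤⟨ ℚ.∣p+q∣≤∣p∣+∣q∣ (a * (b - d)) (d * (a - c)) ⟩
      ℚ.∣ a * (b - d) ∣ + ℚ.∣ d * (a - c) ∣
        ≡⟨ cong₂ _+_ (ℚ.∣p*q∣≡∣p∣*∣q∣ a (b - d)) (ℚ.∣p*q∣≡∣p∣*∣q∣ d (a - c)) ⟩
      ℚ.∣ a ∣ * ℚ.∣ b - d ∣ + ℚ.∣ d ∣ * ℚ.∣ a - c ∣
        ≤⟨ ℚ.+-mono-≤ (*-mono-≤ (ℚ.0≤∣p∣ a) (ℚ.0≤∣p∣ (b - d)) (hA m K≤m) ℚ.≤-refl)
                      (*-mono-≤ (ℚ.0≤∣p∣ d) (ℚ.0≤∣p∣ (a - c)) (hB n L≤n) ℚ.≤-refl) ⟩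
      A * ℚ.∣ b - d ∣ + B * ℚ.∣ a - c ∣
        <⟨ ℚ.+-mono-< (ℚ.*-monoʳ-<-pos A {{positive 0<A}} b-d<δ)
                      (ℚ.*-monoʳ-<-pos B {{positive 0<B}} a-c<δ) ⟩
      A * δ + B * δ
        ≡⟨ solve 4 (λ A B r ε → A :* (r :* ε) :+ B :* (r :* ε) := (A :+ B) :* r :* ε) refl A B (recip (A + B)) ε ⟩
      (A + B) * recip (A + B) * ε
        ≡⟨ cong (_* ε) (recip-inverse 0<A+B) ⟩
      1ℚ * ε
        ≡⟨ ℚ.*-identityˡ ε ⟩
      ε ∎

module RecipCauchy where
  recip-Cauchy : ∀ y → 0ℝ <ℝ y → Cauchy (recip ∘ seq y)
  recip-Cauchy y (mk< δ 0<δ M below) ε 0<ε =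
    let N , h = cauchy y (ε * (δ * δ)) (*-pos 0<ε (*-pos 0<δ 0<δ))
    in M ℕ.⊔ N , λ m n l₁ l₂ →
      let a = seq y m
          b = seq y n
          r = recip a
          s = recip b
          δ≤a = subst (_≤ a) (ℚ.+-identityˡ δ) (below m (ℕ.m⊔n≤o⇒m≤o M N l₁))
          δ≤b = subst (_≤ b) (ℚ.+-identityˡ δ) (below n (ℕ.m⊔n≤o⇒m≤o M N l₂))
          0<a = ℚ.<-≤-trans 0<δ δ≤a
          0<b = ℚ.<-≤-trans 0<δ δ≤b
          0≤ab = ℚ.<⇒≤ (*-pos 0<a 0<b)
      in ℚ.*-cancelʳ-<-nonNeg (a * b) {{nonNegative 0≤ab}} (begin-strict
        ℚ.∣ r - s ∣ * (a * b)
          ≡⟨ cong (ℚ.∣ r - s ∣ *_) (ℚ.0≤p⇒∣p∣≡p 0≤ab) ⟨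
        ℚ.∣ r - s ∣ * ℚ.∣ a * b ∣
          ≡⟨ ℚ.∣p*q∣≡∣p∣*∣q∣ (r - s) (a * b) ⟨
        ℚ.∣ (r - s) * (a * b) ∣
          ≡⟨ cong ℚ.∣_∣ (solve 4 (λ a b r s → (r :- s) :* (a :* b) := (a :* r) :* b :- (b :* s) :* a) refl a b r s) ⟩
        ℚ.∣ (a * r) * b - (b * s) * a ∣
          ≡⟨ cong₂ (λ u v → ℚ.∣ u * b - v * a ∣) (recip-inverse 0<a) (recip-inverse 0<b) ⟩
        ℚ.∣ 1ℚ * b - 1ℚ * a ∣
          ≡⟨ cong₂ (λ u v → ℚ.∣ u - v ∣) (ℚ.*-identityˡ b) (ℚ.*-identityˡ a) ⟩
        ℚ.∣ b - a ∣
          <⟨ h n m (ℕ.m⊔n≤o⇒n≤o M N l₂) (ℕ.m⊔n≤o⇒n≤o M N l₁) ⟩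
        ε * (δ * δ)
          ≤⟨ ℚ.*-monoˡ-≤-nonNeg ε {{nonNegative (ℚ.<⇒≤ 0<ε)}}
               (*-mono-≤ (ℚ.<⇒≤ 0<δ) (ℚ.<⇒≤ 0<b) δ≤a δ≤b) ⟩
        ε * (a * b) ∎)

open RecipCauchy

infixl 7 _/ℝ_
_/ℝ_ : (x y : ℝ) → {{0ℝ <ℝ y}} → ℝ
_/ℝ_ x y {{0<y}} = x *ℝ mkℝ (recip ∘ seq y) (recip-Cauchy y 0<y)

Σ< : ℕ → (ℕ → ℚ) → ℚ
Σ< zero    f = 0ℚ
Σ< (suc N) f = Σ< N f + f N

unit : ℕ → ℚ
unit i = + 1 / suc i

-- The j-th term is the right Riemann sum of ∫₁ⁿ dt/t with mesh 1/(j+1):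
-- the i-th interval contributes (1/(j+1)) · 1/(1 + (i+1)/(j+1)) = 1/(j+1+i+1).
-- The value at n = 0 is junk (α (G [ k ]) is never 0 when G has a vertex).
logSeq : ℕ → ℕ → ℚ
logSeq n j = Σ< (pred n ℕ.* suc j) λ i → unit (suc j ℕ.+ i)

module LogLemmas where
  fromℕℚ : ℕ → ℚ
  fromℕℚ zero    = 0ℚ
  fromℕℚ (suc n) = fromℕℚ n + 1ℚ

  unit≡mkℚ : ∀ i → unit i ≡ mkℚ (+ 1) i (Coprime.1-coprimeTo (suc i))
  unit≡mkℚ i = ℚ.normalize-coprime (Coprime.1-coprimeTo (suc i))

  unit-antitone : ∀ {i j} → i ℕ.≤ j → unit j ≤ unit i
  unit-antitone {i} {j} i≤j rewrite unit≡mkℚ i | unit≡mkℚ j =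
    *≤* (ℤ.+≤+ (ℕ.+-monoˡ-≤ 0 (s≤s i≤j)))

  unit-nonneg : ∀ i → 0ℚ ≤ unit i
  unit-nonneg i rewrite unit≡mkℚ i = *≤* (ℤ.+≤+ z≤n)

  fromℕℚ-mkℚ : ∀ n → fromℕℚ n ≡ mkℚ (+ n) 0 (Coprime.sym (Coprime.1-coprimeTo n))
  fromℕℚ-mkℚ zero = refl
  fromℕℚ-mkℚ (suc n) rewrite fromℕℚ-mkℚ n = trans
    (ℚ./-cong {p₁ = + n ℤ.* + 1 ℤ.+ + 1 ℤ.* + 1} {q₁ = 1} {p₂ = + suc n} {q₂ = 1}
      (trans (cong (ℤ._+ + 1) (ℤ.*-identityʳ (+ n))) (cong +_ (ℕ.+-comm n 1))) refl)
    (ℚ.normalize-coprime (Coprime.sym (Coprime.1-coprimeTo (suc n))))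

  unit-inverse : ∀ i → fromℕℚ (suc i) * unit i ≡ 1ℚ
  unit-inverse i rewrite fromℕℚ-mkℚ (suc i) | unit≡mkℚ i = ℚ.toℚᵘ-injective (ℚᵘ.≃-trans
    (ℚ.toℚᵘ-homo-* (mkℚ (+ suc i) 0 (Coprime.sym (Coprime.1-coprimeTo (suc i))))
                   (mkℚ (+ 1) i (Coprime.1-coprimeTo (suc i))))
    (ℚᵘ.*≡* (cong +_ (trans (ℕ.*-identityʳ _) (trans (ℕ.*-identityʳ _)
      (sym (trans (ℕ.*-identityˡ _) (ℕ.*-identityˡ _))))))))

  fromℕℚ-* : ∀ m n → fromℕℚ (m ℕ.* n) ≡ fromℕℚ m * fromℕℚ n
  fromℕℚ-+ : ∀ m n → fromℕℚ (m ℕ.+ n) ≡ fromℕℚ m + fromℕℚ n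
  fromℕℚ-+ zero    n = sym (ℚ.+-identityˡ _)
  fromℕℚ-+ (suc m) n = trans (cong (_+ 1ℚ) (fromℕℚ-+ m n))
    (solve 2 (λ a b → a :+ b :+ con 1ℚ := a :+ con 1ℚ :+ b) refl (fromℕℚ m) (fromℕℚ n))
  fromℕℚ-* zero    n = sym (ℚ.*-zeroˡ (fromℕℚ n))
  fromℕℚ-* (suc m) n = trans (fromℕℚ-+ n (m ℕ.* n)) (trans (cong (λ x → fromℕℚ n + x) (fromℕℚ-* m n))
    (solve 2 (λ a b → b :+ a :* b := (a :+ con 1ℚ) :* b) refl (fromℕℚ m) (fromℕℚ n)))

  unit-scale : ∀ i l → fromℕℚ (suc l) * unit (l ℕ.+ i ℕ.* suc l) ≡ unit i
  unit-scale i l = let I = fromℕℚ (suc i) ; L = fromℕℚ (suc l)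
                       u = unit i ; w = unit (l ℕ.+ i ℕ.* suc l) in begin-equality
    L * w              ≡⟨ ℚ.*-identityˡ (L * w) ⟨
    1ℚ * (L * w)       ≡⟨ cong (_* (L * w)) (unit-inverse i) ⟨
    I * u * (L * w)    ≡⟨ solve 4 (λ I u L w → I :* u :* (L :* w) := I :* L :* w :* u) refl I u L w ⟩
    I * L * w * u      ≡⟨ cong (λ x → x * w * u) (fromℕℚ-* (suc i) (suc l)) ⟨
    fromℕℚ (suc i ℕ.* suc l) * w * u
                       ≡⟨ cong (_* u) (unit-inverse (l ℕ.+ i ℕ.* suc l)) ⟩
    1ℚ * u             ≡⟨ ℚ.*-identityˡ u ⟩
    u                  ∎

  Σ<-cong : ∀ N {f g : ℕ → ℚ} → (∀ i → f i ≡ g i) → Σ< N f ≡ Σ< N g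
  Σ<-cong zero    f≡g = refl
  Σ<-cong (suc N) f≡g = cong₂ _+_ (Σ<-cong N f≡g) (f≡g N)

  Σ<-mono : ∀ N {f g : ℕ → ℚ} → (∀ i → f i ≤ g i) → Σ< N f ≤ Σ< N g
  Σ<-mono zero    f≤g = ℚ.≤-refl
  Σ<-mono (suc N) f≤g = ℚ.+-mono-≤ (Σ<-mono N f≤g) (f≤g N)

  Σ<-upper : ∀ N {f : ℕ → ℚ} {c} → (∀ i → i ℕ.< N → f i ≤ c) → Σ< N f ≤ fromℕℚ N * c
  Σ<-upper zero    {c = c} h = ℚ.≤-reflexive (sym (ℚ.*-zeroˡ c))
  Σ<-upper (suc N) {f} {c} h = begin
    Σ< N f + f N            ≤⟨ ℚ.+-mono-≤ (Σ<-upper N λ i i<N → h i (ℕ.m<n⇒m<1+n i<N))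
                                           (h N ℕ.≤-refl) ⟩
    fromℕℚ N * c + c        ≡⟨ solve 2 (λ n c → n :* c :+ c := (n :+ con 1ℚ) :* c) refl (fromℕℚ N) c ⟩
    (fromℕℚ N + 1ℚ) * c     ∎

  Σ<-lower : ∀ N {f : ℕ → ℚ} {c} → (∀ i → i ℕ.< N → c ≤ f i) → fromℕℚ N * c ≤ Σ< N f
  Σ<-lower zero    {c = c} h = ℚ.≤-reflexive (ℚ.*-zeroˡ c)
  Σ<-lower (suc N) {f} {c} h = begin
    (fromℕℚ N + 1ℚ) * c     ≡⟨ solve 2 (λ n c → (n :+ con 1ℚ) :* c := n :* c :+ c) refl (fromℕℚ N) c ⟩
    fromℕℚ N * c + c        ≤⟨ ℚ.+-mono-≤ (Σ<-lower N λ i i<N → h i (ℕ.m<n⇒m<1+n i<N))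
                                           (h N ℕ.≤-refl) ⟩
    Σ< N f + f N            ∎

  Σ<-split : ∀ p q f → Σ< (p ℕ.+ q) f ≡ Σ< p f + Σ< q (λ i → f (p ℕ.+ i))
  Σ<-split p zero    f = trans (cong (λ r → Σ< r f) (ℕ.+-identityʳ p)) (sym (ℚ.+-identityʳ _))
  Σ<-split p (suc q) f = trans (cong (λ r → Σ< r f) (ℕ.+-suc p q))
    (trans (cong (_+ f (p ℕ.+ q)) (Σ<-split p q f)) (ℚ.+-assoc (Σ< p f) (Σ< q λ i → f (p ℕ.+ i)) (f (p ℕ.+ q))))

  Σ<-blocks : ∀ M m f → Σ< (M ℕ.* m) f ≡ Σ< M λ a → Σ< m λ b → f (a ℕ.* m ℕ.+ b)
  Σ<-blocks zero    m f = refl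
  Σ<-blocks (suc M) m f = trans (cong (λ r → Σ< r f) (ℕ.+-comm m (M ℕ.* m)))
    (trans (Σ<-split (M ℕ.* m) m f)
      (cong (_+ Σ< m λ b → f (M ℕ.* m ℕ.+ b)) (Σ<-blocks M m f)))

  refined : ℕ → ℕ → ℕ
  refined j l = l ℕ.+ j ℕ.* suc l

  module Refine (j l : ℕ) where
    block : ℕ → ℚ
    block a = Σ< (suc l) λ b → unit (suc (refined j l) ℕ.+ (a ℕ.* suc l ℕ.+ b))

    position : ∀ a b → suc (refined j l) ℕ.+ (a ℕ.* suc l ℕ.+ b) ≡ suc (refined (j ℕ.+ a) l) ℕ.+ b
    position a b = trans (sym (ℕ.+-assoc (suc j ℕ.* suc l) (a ℕ.* suc l) b))
      (cong (ℕ._+ b) (sym (ℕ.*-distribʳ-+ (suc l) (suc j) a)))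

    block-upper : ∀ a → block a ≤ unit (j ℕ.+ a)
    block-upper a = begin
      block a
        ≤⟨ Σ<-upper (suc l) (λ b _ → unit-antitone (subst (refined (j ℕ.+ a) l ℕ.≤_)
             (sym (position a b)) (ℕ.m≤n⇒m≤o+n 1 (ℕ.m≤m+n _ b)))) ⟩
      fromℕℚ (suc l) * unit (refined (j ℕ.+ a) l)
        ≡⟨ unit-scale (j ℕ.+ a) l ⟩
      unit (j ℕ.+ a) ∎

    block-lower : ∀ a → unit (suc j ℕ.+ a) ≤ block a
    block-lower a = begin
      unit (suc j ℕ.+ a)
        ≡⟨ unit-scale (suc j ℕ.+ a) l ⟨
      fromℕℚ (suc l) * unit (refined (suc j ℕ.+ a) l)
        ≤⟨ Σ<-lower (suc l) (λ b b<m → unit-antitone (subst (ℕ._≤ refined (suc j ℕ.+ a) l)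
             (sym (position a b)) (ℕ.≤-trans (ℕ.+-monoʳ-≤ (suc (refined (j ℕ.+ a) l)) (ℕ.≤-pred b<m))
               (ℕ.≤-reflexive (ℕ.+-comm (suc (refined (j ℕ.+ a) l)) l))))) ⟩
      block a ∎

    coarse : ℕ → ℚ
    coarse M = Σ< M λ a → unit (suc j ℕ.+ a)

    telescope : ∀ M → Σ< M block + unit (j ℕ.+ M) ≤ coarse M + unit j
    telescope zero    = ℚ.≤-reflexive (cong (λ i → 0ℚ + unit i) (ℕ.+-identityʳ j))
    telescope (suc M) = let T = Σ< M block ; v = unit (suc j ℕ.+ M) in begin
      T + block M + unit (j ℕ.+ suc M)
        ≤⟨ ℚ.+-mono-≤ (ℚ.+-monoʳ-≤ T (block-upper M)) (ℚ.≤-reflexive (cong unit (ℕ.+-suc j M))) ⟩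
      T + unit (j ℕ.+ M) + v
        ≤⟨ ℚ.+-monoˡ-≤ v (telescope M) ⟩
      coarse M + unit j + v
        ≡⟨ solve 3 (λ s u v → s :+ u :+ v := s :+ v :+ u) refl (coarse M) (unit j) v ⟩
      coarse M + v + unit j ∎

    blocks : ∀ n → logSeq n (refined j l) ≡ Σ< (pred n ℕ.* suc j) block
    blocks n = trans
      (cong (λ r → Σ< r λ i → unit (suc (refined j l) ℕ.+ i))
        (sym (ℕ.*-assoc (pred n) (suc j) (suc l))))
      (Σ<-blocks (pred n ℕ.* suc j) (suc l) λ i → unit (suc (refined j l) ℕ.+ i))

    lower : ∀ n → logSeq n j ≤ logSeq n (refined j l)
    lower n = subst (logSeq n j ≤_) (sym (blocks n)) (Σ<-mono (pred n ℕ.* suc j) block-lower)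

    upper : ∀ n → logSeq n (refined j l) ≤ logSeq n j + unit j
    upper n = let M = pred n ℕ.* suc j in begin
      logSeq n (refined j l)          ≡⟨ blocks n ⟩
      Σ< M block                      ≡⟨ ℚ.+-identityʳ _ ⟨
      Σ< M block + 0ℚ                 ≤⟨ ℚ.+-monoʳ-≤ (Σ< M block) (unit-nonneg (j ℕ.+ M)) ⟩
      Σ< M block + unit (j ℕ.+ M)     ≤⟨ telescope M ⟩
      logSeq n j + unit j             ∎

  refined-comm : ∀ j l → refined j l ≡ refined l j
  refined-comm j l = ℕ.suc-injective (ℕ.*-comm (suc j) (suc l))

  logSeq-close : ∀ n j l → logSeq n j - logSeq n l ≤ unit l
  logSeq-close n j l = shift (begin
    logSeq n j              ≤⟨ Refine.lower j l n ⟩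
    logSeq n (refined j l)  ≡⟨ cong (logSeq n) (refined-comm j l) ⟩
    logSeq n (refined l j)  ≤⟨ Refine.upper l j n ⟩
    logSeq n l + unit l     ≡⟨ ℚ.+-comm (logSeq n l) (unit l) ⟩
    unit l + logSeq n l     ∎)

  archimedean : ∀ ε → 0ℚ < ε → ∃ λ N → unit N < ε
  archimedean ε@(mkℚ (+ suc p) d _)   _ = suc d , subst (_< ε) (sym (unit≡mkℚ (suc d)))
    (*<* (ℤ.+<+ (ℕ.<-≤-trans (s≤s (ℕ.≤-reflexive (ℕ.+-identityʳ (suc d))))
                             (ℕ.m≤m+n (suc (suc d)) (p ℕ.* suc (suc d))))))
  archimedean (mkℚ (+ zero) d _)      (*<* (ℤ.+<+ ()))
  archimedean (mkℚ (ℤ.-[1+ p ]) d _)  (*<* ())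

  logSeq-Cauchy : ∀ n → Cauchy (logSeq n)
  logSeq-Cauchy n ε 0<ε =
    let N , unitN<ε = archimedean ε 0<ε in
    N , λ j l N≤j N≤l → ℚ.≤-<-trans
      (∣∣-≤ (ℚ.≤-trans (logSeq-close n j l) (unit-antitone N≤l))
            (begin
              - (logSeq n j - logSeq n l)
                ≡⟨ solve 2 (λ a b → :- (a :- b) := b :- a) refl (logSeq n j) (logSeq n l) ⟩
              logSeq n l - logSeq n j  ≤⟨ logSeq-close n l j ⟩
              unit j                   ≤⟨ unit-antitone N≤j ⟩
              unit N                   ∎))
      unitN<ε

open LogLemmas

log : ℕ → ℝ
log n = mkℝ (logSeq n) (logSeq-Cauchy n)

module LogPositive where
  logSeq≥½ : ∀ n → 1 ℕ.< n → ∀ j → 0ℚ + ½ ≤ logSeq n j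
  logSeq≥½ (suc zero)    (s≤s ()) j
  logSeq≥½ (suc (suc n)) _ j = let f = λ i → unit (suc j ℕ.+ i) in begin
    0ℚ + ½                                        ≡⟨⟩
    unit 1                                        ≡⟨ unit-scale 1 j ⟨
    fromℕℚ (suc j) * unit (j ℕ.+ 1 ℕ.* suc j)     ≤⟨ Σ<-lower (suc j) (λ i i≤j → unit-antitone (bound i i≤j)) ⟩
    Σ< (suc j) f                                  ≡⟨ ℚ.+-identityʳ _ ⟨
    Σ< (suc j) f + 0ℚ                             ≤⟨ ℚ.+-monoʳ-≤ (Σ< (suc j) f) rest≥0 ⟩
    Σ< (suc j) f + Σ< (n ℕ.* suc j) (λ i → f (suc j ℕ.+ i))
                                                  ≡⟨ Σ<-split (suc j) (n ℕ.* suc j) f ⟨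
    logSeq (suc (suc n)) j                        ∎
    where
    bound : ∀ i → i ℕ.< suc j → suc j ℕ.+ i ℕ.≤ j ℕ.+ 1 ℕ.* suc j
    bound i i<sj = ℕ.≤-trans (ℕ.+-monoʳ-≤ (suc j) (ℕ.≤-pred i<sj)) (ℕ.≤-reflexive
      (trans (ℕ.+-comm (suc j) j) (cong (j ℕ.+_) (sym (ℕ.*-identityˡ (suc j))))))

    rest≥0 : 0ℚ ≤ Σ< (n ℕ.* suc j) (λ i → unit (suc j ℕ.+ (suc j ℕ.+ i)))
    rest≥0 = ℚ.≤-trans (ℚ.≤-reflexive (sym (ℚ.*-zeroʳ (fromℕℚ (n ℕ.* suc j)))))
      (Σ<-lower (n ℕ.* suc j) (λ i _ → unit-nonneg (suc j ℕ.+ (suc j ℕ.+ i))))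

open LogPositive

instance
  log-positive : ∀ {n} → .{{NonTrivial n}} → 0ℝ <ℝ log n
  log-positive {n} = mk< ½ (ℚ.positive⁻¹ ½) 0 λ j _ → logSeq≥½ n (nonTrivial⇒n>1 n) j

-- For sequences defined at k ≥ 2, which is where log k is invertible.
Limit : ((k : ℕ) → .{{NonTrivial k}} → ℝ) → ℝ → Set
Limit x L = ∀ ε → 0ℝ <ℝ ε →
  ∃ λ K → ∀ k → .{{_ : NonTrivial k}} → K ℕ.≤ k → ∣ x k -ℝ L ∣ℝ <ℝ ε

{-# OPTIONS --safe #-}

-- Let a = α(G). A move between two configurations supported on a maximum independent set moves no
-- pebble, so α(G[k]) is at least the number C(k+a-1, a-1) of these configurations.
--
-- Conversely, cut ℕ into intervals ("classes") that are short relative to their elements but so few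
-- that any power of their number up to k is O(k). The classes of the values of a configuration f
-- order the vertices by size; a greedy independent set M for this order partitions the graph into
-- stars, each leaf being no larger than its centre in M. If f and g have the same classes and the
-- same total on every star, then their differences at the leaves are small compared to the values
-- at the centres, and can be evened out by moving pebbles between leaves and centres. Thus classes
-- and star totals cover G[k] by cliques; there are at most (k+1)^(a-1) totals, since |M| ≤ a.
--
-- In the e-th powers of both bounds the constants are absorbed by k for large k, so the ratio of
-- logarithms is within 3/e of a-1.

module Submission where

open import Defs
open import Data.Bool.Base using (true; false; if_then_else_)
open import Data.Fin.Base using (Fin; zero; suc; combine; finToFun; funToFin; fromℕ<; toℕ)
import Data.Fin.Properties as Fin
open import Data.Fin.Subset using (Subset; inside; outside; _∈_; _∉_; ∣_∣; ⊥; _∪_; ⁅_⁆)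
open import Data.Fin.Subset.Properties
  using (_∈?_; ∉⊥; x∈⁅x⁆; x∈⁅y⁆⇒x≡y; x∈p∪q⁺; x∈p∪q⁻; drop-there)
open import Data.List.Base as List using ([]; _∷_)
open import Data.List.Membership.Propositional using () renaming (_∈_ to _∈ˡ_)
open import Data.List.Membership.Propositional.Properties using (∈-allFin)
open import Data.List.Relation.Binary.Permutation.Propositional using (↭-sym)
open import Data.List.Relation.Binary.Permutation.Propositional.Properties using (∈-resp-↭)
open import Data.List.Relation.Unary.All as All using ()
open import Data.List.Relation.Unary.AllPairs using (AllPairs; []; _∷_)
open import Data.List.Relation.Unary.Any using (here; there)
import Data.List.Relation.Unary.Sorted.TotalOrder.Properties as Sorted
import Data.List.Sort as Sort
open import Data.Nat.Base as ℕ using (ℕ; zero; suc; pred; nonTrivial⇒n>1)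
import Data.Nat.Coprimality as Coprime
open import Data.Nat.DivMod using (m/n*n≤m; m/n≤m; m%n<n; m≡m%n+[m/n]*n)
import Data.Nat.Properties as ℕ
open import Data.Nat.Tactic.RingSolver using (solve-∀)
open import Data.Product.Base using (∃; _×_; _,_; proj₁; proj₂)
import Data.Rational.Base as ℚ
import Data.Rational.Properties as ℚ
open import Data.Rational.Solver using (module +-*-Solver)
open import Data.Sum.Base using (_⊎_; inj₁; inj₂)
open import Data.Vec.Base as Vec using (Vec; []; _∷_; lookup; tabulate)
import Data.Vec.Properties as Vec
open import Function.Base using (_∘_; id)
open import Function.Bundles using (Inverse)
open import Relation.Binary.Bundles using (DecTotalOrder)
import Relation.Binary.Construct.On as On
open import Relation.Binary.PropositionalEquality hiding ([_])
open import Relation.Nullary using (yes; no; does; contradiction; ¬_)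
open import Relation.Nullary.Decidable using (_×-dec_; dec-true)

-- Logarithms

module LogGrowth where
  open import Data.Integer.Base using (+_)
  open import Data.Rational.Base
    using (ℚ; 0ℚ; 1ℚ; ½; _+_; _*_; _-_; -_; _/_; _≤_; _<_; positive; nonNegative)
  open ℚ.≤-Reasoning
  open +-*-Solver using (solve; _:=_; _:+_; _:*_; _:-_; :-_; con)
  open RationalLemmas using (*-pos; ∣∣-≤)
  open RecipLemmas
  open LogLemmas
  open LogPositive using (logSeq≥½)
  open ℝ using (seq)

  0≤fromℕℚ : ∀ n → 0ℚ ≤ fromℕℚ n
  0≤fromℕℚ zero    = ℚ.≤-refl
  0≤fromℕℚ (suc n) = ℚ.+-mono-≤ (0≤fromℕℚ n) (ℚ.nonNegative⁻¹ 1ℚ)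

  fromℕℚ-mono : ∀ {m n} → m ℕ.≤ n → fromℕℚ m ≤ fromℕℚ n
  fromℕℚ-mono {n = n} ℕ.z≤n       = 0≤fromℕℚ n
  fromℕℚ-mono         (ℕ.s≤s m≤n) = ℚ.+-monoˡ-≤ 1ℚ (fromℕℚ-mono m≤n)

  logSeq-mono : ∀ j {m n} → m ℕ.≤ n → logSeq m j ≤ logSeq n j
  logSeq-mono j {m} {n} m≤n = begin
    logSeq m j                     ≡⟨ ℚ.+-identityʳ _ ⟨
    Σ< M f + 0ℚ                    ≤⟨ ℚ.+-monoʳ-≤ (Σ< M f) rest≥0 ⟩
    Σ< M f + Σ< R (λ i → f (M ℕ.+ i)) ≡⟨ Σ<-split M R f ⟨
    Σ< (M ℕ.+ R) f                 ≡⟨ cong (λ r → Σ< r f) (ℕ.m+[n∸m]≡n (ℕ.*-monoˡ-≤ (suc j) (ℕ.pred-mono-≤ m≤n))) ⟩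
    logSeq n j                     ∎
    where
    f = λ i → unit (suc j ℕ.+ i)
    M = pred m ℕ.* suc j
    R = pred n ℕ.* suc j ℕ.∸ M
    rest≥0 : 0ℚ ≤ Σ< R (λ i → f (M ℕ.+ i))
    rest≥0 = ℚ.≤-trans (ℚ.≤-reflexive (sym (ℚ.*-zeroʳ (fromℕℚ R))))
      (Σ<-lower R λ i _ → unit-nonneg (suc j ℕ.+ (M ℕ.+ i)))

  -- ∫₁^mn = ∫₁^m + ∫_m^mn, and rescaling the last integral by m only refines its mesh.
  logSeq-* : ∀ m n j → logSeq (suc m ℕ.* suc n) j ≡ logSeq (suc m) j + logSeq (suc n) (refined j m)
  logSeq-* m n j = begin-equality
    Σ< ((n ℕ.+ m ℕ.* suc n) ℕ.* suc j) f     ≡⟨ cong (λ r → Σ< r f) (range m n j) ⟩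
    Σ< (M ℕ.+ R) f                           ≡⟨ Σ<-split M R f ⟩
    Σ< M f + Σ< R (λ i → f (M ℕ.+ i))        ≡⟨ cong (λ s → Σ< M f + s) (Σ<-cong R λ i → cong unit (position m j i)) ⟩
    logSeq (suc m) j + logSeq (suc n) (refined j m) ∎
    where
    f = λ i → unit (suc j ℕ.+ i)
    M = m ℕ.* suc j
    R = n ℕ.* suc (refined j m)
    range : ∀ m n j → (n ℕ.+ m ℕ.* suc n) ℕ.* suc j ≡ m ℕ.* suc j ℕ.+ n ℕ.* (suc j ℕ.* suc m)
    range = solve-∀
    position : ∀ m j i → suc j ℕ.+ (m ℕ.* suc j ℕ.+ i) ≡ suc j ℕ.* suc m ℕ.+ i
    position = solve-∀

  logSeq-*-lower : ∀ {m n} j → 1 ℕ.≤ m → 1 ℕ.≤ n → logSeq m j + logSeq n j ≤ logSeq (m ℕ.* n) j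
  logSeq-*-lower {suc m} {suc n} j _ _ = subst (logSeq (suc m) j + logSeq (suc n) j ≤_)
    (sym (logSeq-* m n j)) (ℚ.+-monoʳ-≤ (logSeq (suc m) j) (Refine.lower j m (suc n)))

  -- Refining the mesh raises a right Riemann sum of 1/t by at most `unit j`, so at a fixed index
  -- the functional equation of the logarithm holds up to this error.
  logSeq-*-upper : ∀ {m n} j → 1 ℕ.≤ m → 1 ℕ.≤ n →
                   logSeq (m ℕ.* n) j ≤ logSeq m j + (logSeq n j + unit j)
  logSeq-*-upper {suc m} {suc n} j _ _ = subst (_≤ logSeq (suc m) j + (logSeq (suc n) j + unit j))
    (sym (logSeq-* m n j)) (ℚ.+-monoʳ-≤ (logSeq (suc m) j) (Refine.upper j m (suc n)))

  1≤^ : ∀ {m} p → 1 ℕ.≤ m → 1 ℕ.≤ m ℕ.^ p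
  1≤^ {m} p 1≤m = ℕ.m^n>0 m {{ℕ.>-nonZero 1≤m}} p

  logSeq-^-lower : ∀ {m} p j → 1 ℕ.≤ m → fromℕℚ p * logSeq m j ≤ logSeq (m ℕ.^ p) j
  logSeq-^-lower {m} zero    j 1≤m = ℚ.≤-reflexive (ℚ.*-zeroˡ (logSeq m j))
  logSeq-^-lower {m} (suc p) j 1≤m = begin
    (fromℕℚ p + 1ℚ) * logSeq m j          ≡⟨ solve 2 (λ p l → (p :+ con 1ℚ) :* l := l :+ p :* l) refl (fromℕℚ p) (logSeq m j) ⟩
    logSeq m j + fromℕℚ p * logSeq m j    ≤⟨ ℚ.+-monoʳ-≤ (logSeq m j) (logSeq-^-lower p j 1≤m) ⟩
    logSeq m j + logSeq (m ℕ.^ p) j       ≤⟨ logSeq-*-lower j 1≤m (1≤^ p 1≤m) ⟩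
    logSeq (m ℕ.^ suc p) j                ∎

  logSeq-^-upper : ∀ {m} p j → 1 ℕ.≤ m → logSeq (m ℕ.^ p) j ≤ fromℕℚ p * (logSeq m j + unit j)
  logSeq-^-upper {m} zero    j 1≤m = ℚ.≤-reflexive (sym (ℚ.*-zeroˡ (logSeq m j + unit j)))
  logSeq-^-upper {m} (suc p) j 1≤m = begin
    logSeq (m ℕ.^ suc p) j                       ≤⟨ logSeq-*-upper j 1≤m (1≤^ p 1≤m) ⟩
    l + (logSeq (m ℕ.^ p) j + u)                 ≤⟨ ℚ.+-monoʳ-≤ l (ℚ.+-monoˡ-≤ u (logSeq-^-upper p j 1≤m)) ⟩
    l + (fromℕℚ p * (l + u) + u)                 ≡⟨ solve 3 (λ p l u → l :+ (p :* (l :+ u) :+ u) := (p :+ con 1ℚ) :* (l :+ u)) refl (fromℕℚ p) l u ⟩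
    (fromℕℚ p + 1ℚ) * (l + u)                    ∎
    where
    l = logSeq m j
    u = unit j

  -- At the threshold for `j`, `unit` takes the value 1/(2(q+1)), so q+1 mesh errors add up to at
  -- most ½, which is the lower bound of `logSeq≥½` for log k.
  multiple-small : ∀ q j → q ℕ.+ 1 ℕ.* suc q ℕ.≤ j → ∀ {r} → r ℕ.≤ suc q → fromℕℚ r * unit j ≤ ½
  multiple-small q j J≤j {r} r≤1+q = begin
    fromℕℚ r * unit j                           ≤⟨ RationalLemmas.*-mono-≤ (0≤fromℕℚ r) (unit-nonneg (q ℕ.+ 1 ℕ.* suc q))
                                                     (fromℕℚ-mono r≤1+q) (unit-antitone J≤j) ⟩
    fromℕℚ (suc q) * unit (q ℕ.+ 1 ℕ.* suc q)   ≡⟨ unit-scale 1 q ⟩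
    ½                                           ∎

  3ℚ : ℚ
  3ℚ = fromℕℚ 3

  -- Here w stands for 1/E and r for 1/L.
  scaled-difference : ∀ x P E w L r c → E * w ≡ 1ℚ → L * r ≡ 1ℚ → 0ℚ ≤ w → 0ℚ ≤ r →
                      E * x ≤ P * E * L + c * L → P * E * L ≤ E * x + c * L →
                      ℚ.∣ x * r - P ∣ ≤ c * w
  scaled-difference x P E w L r c Ew Lr 0≤w 0≤r upper lower = ∣∣-≤
    (begin
      x * r - P                                  ≡⟨ normalised ⟩
      E * w * (x * r) - E * w * (L * r * P)
        ≡⟨ solve 6 (λ x P E w L r → E :* w :* (x :* r) :- E :* w :* (L :* r :* P) :=
             w :* r :* (E :* x :- P :* E :* L)) refl x P E w L r ⟩
      w * r * (E * x - P * E * L)                ≤⟨ scale (RationalLemmas.shift (subst (E * x ≤_) (ℚ.+-comm (P * E * L) (c * L)) upper)) ⟩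
      w * r * (c * L)                            ≡⟨ cancel ⟩
      c * w ∎)
    (begin
      - (x * r - P)                              ≡⟨ cong -_ normalised ⟩
      - (E * w * (x * r) - E * w * (L * r * P))
        ≡⟨ solve 6 (λ x P E w L r → :- (E :* w :* (x :* r) :- E :* w :* (L :* r :* P)) :=
             w :* r :* (P :* E :* L :- E :* x)) refl x P E w L r ⟩
      w * r * (P * E * L - E * x)                ≤⟨ scale (RationalLemmas.shift (subst (P * E * L ≤_) (ℚ.+-comm (E * x) (c * L)) lower)) ⟩
      w * r * (c * L)                            ≡⟨ cancel ⟩
      c * w ∎)
    where
    -- Inserting `E * w` and `L * r`, both equal to 1, lets the common factor `w * r` be taken out.
    normalised : x * r - P ≡ E * w * (x * r) - E * w * (L * r * P)
    normalised = trans
      (solve 3 (λ x r P → x :* r :- P := con 1ℚ :* (x :* r) :- con 1ℚ :* (con 1ℚ :* P)) refl x r P)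
      (sym (cong₂ (λ a b → a * (x * r) - a * (b * P)) Ew Lr))

    scale : ∀ {a b} → a ≤ b → w * r * a ≤ w * r * b
    scale = ℚ.*-monoˡ-≤-nonNeg (w * r) {{ℚ.nonNeg*nonNeg⇒nonNeg w {{nonNegative 0≤w}} r {{nonNegative 0≤r}}}}

    cancel : w * r * (c * L) ≡ c * w
    cancel = trans (solve 4 (λ w r c L → w :* r :* (c :* L) := c :* w :* (L :* r)) refl w r c L)
      (trans (cong (c * w *_) Lr) (ℚ.*-identityʳ (c * w)))

  -- Logarithms turn the power inequalities into linear ones between e · log A and p · e · log k.
  -- From above, the two extra factors `k` cost 2L and the mesh errors at most L; from below, the
  -- factor `k` and the mesh errors cost at most L each. Dividing by e · L leaves 3/e.
  log-ratio : ∀ {A k} p N → 1 ℕ.< k → let e = suc N ; q = 2 ℕ.+ p ℕ.* e ℕ.+ e in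
              k ℕ.^ (p ℕ.* e) ℕ.≤ A ℕ.^ e ℕ.* k → A ℕ.^ e ℕ.≤ k ℕ.^ (2 ℕ.+ p ℕ.* e) →
              ∀ j → q ℕ.+ 1 ℕ.* suc q ℕ.≤ j →
              ℚ.∣ logSeq A j * recip (logSeq k j) - fromℕℚ p ∣ ≤ 3ℚ * unit N
  -- Since `e` is positive, `A = 0` would make the right side of `lower` vanish.
  log-ratio {zero}      {k} p N 1<k lower _ _ _ = contradiction lower (ℕ.<⇒≱ (1≤^ (p ℕ.* suc N) (ℕ.<⇒≤ 1<k)))
  log-ratio {A@(suc _)} {k} p N 1<k lower upper j J≤j = scaled-difference a P E (unit N) L (recip L) 3ℚ
    (unit-inverse N) (recip-inverse 0<L) (unit-nonneg N) (ℚ.<⇒≤ (recip-pos 0<L))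
    (begin
      E * a                                  ≤⟨ logSeq-^-lower e j 1≤A ⟩
      logSeq (A ℕ.^ e) j                     ≤⟨ logSeq-mono j upper ⟩
      logSeq (k ℕ.^ (2 ℕ.+ p ℕ.* e)) j       ≤⟨ logSeq-^-upper (2 ℕ.+ p ℕ.* e) j 1≤k ⟩
      (R + 1ℚ + 1ℚ) * (L + u)                ≡⟨ ℚ.*-distribˡ-+ (R + 1ℚ + 1ℚ) L u ⟩
      (R + 1ℚ + 1ℚ) * L + (R + 1ℚ + 1ℚ) * u  ≤⟨ ℚ.+-monoʳ-≤ ((R + 1ℚ + 1ℚ) * L)
                                                  (small {2 ℕ.+ p ℕ.* e} (ℕ.m≤n⇒m≤1+n (ℕ.m≤m+n _ e))) ⟩
      (R + 1ℚ + 1ℚ) * L + L                  ≡⟨ solve 2 (λ R L → (R :+ con 1ℚ :+ con 1ℚ) :* L :+ L := R :* L :+ con 3ℚ :* L) refl R L ⟩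
      R * L + 3ℚ * L                         ≡⟨ cong (λ x → x * L + 3ℚ * L) (fromℕℚ-* p e) ⟩
      P * E * L + 3ℚ * L                     ∎)
    (begin
      P * E * L                              ≡⟨ cong (_* L) (fromℕℚ-* p e) ⟨
      R * L                                  ≤⟨ logSeq-^-lower (p ℕ.* e) j 1≤k ⟩
      logSeq (k ℕ.^ (p ℕ.* e)) j             ≤⟨ logSeq-mono j lower ⟩
      logSeq (A ℕ.^ e ℕ.* k) j               ≤⟨ logSeq-*-upper j (1≤^ e 1≤A) 1≤k ⟩
      logSeq (A ℕ.^ e) j + (L + u)           ≤⟨ ℚ.+-monoˡ-≤ (L + u) (logSeq-^-upper e j 1≤A) ⟩
      E * (a + u) + (L + u)                  ≡⟨ solve 4 (λ E a u L → E :* (a :+ u) :+ (L :+ u) := E :* a :+ L :+ (E :+ con 1ℚ) :* u) refl E a u L ⟩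
      E * a + L + (E + 1ℚ) * u               ≤⟨ ℚ.+-monoʳ-≤ (E * a + L) (small {suc e} (ℕ.s≤s (ℕ.m≤n+m e (2 ℕ.+ p ℕ.* e)))) ⟩
      -- The sum is padded with a third `L` so that both directions have the constant 3.
      E * a + L + L                          ≡⟨ ℚ.+-identityʳ _ ⟨
      E * a + L + L + 0ℚ                     ≤⟨ ℚ.+-monoʳ-≤ (E * a + L + L) (ℚ.<⇒≤ 0<L) ⟩
      E * a + L + L + L                      ≡⟨ solve 2 (λ x L → x :+ L :+ L :+ L := x :+ con 3ℚ :* L) refl (E * a) L ⟩
      E * a + 3ℚ * L                         ∎)
    where
    e = suc N
    1≤k = ℕ.<⇒≤ 1<k
    1≤A : 1 ℕ.≤ A
    1≤A = ℕ.s≤s ℕ.z≤n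
    a = logSeq A j
    L = logSeq k j
    u = unit j
    P = fromℕℚ p
    E = fromℕℚ e
    R = fromℕℚ (p ℕ.* e)
    ½≤L : ½ ≤ L
    ½≤L = logSeq≥½ k 1<k j
    0<L : 0ℚ < L
    0<L = ℚ.<-≤-trans (ℚ.positive⁻¹ ½) ½≤L
    small : ∀ {r} → r ℕ.≤ suc (2 ℕ.+ p ℕ.* e ℕ.+ e) → fromℕℚ r * u ≤ L
    small r≤ = ℚ.≤-trans (multiple-small (2 ℕ.+ p ℕ.* e ℕ.+ e) j J≤j r≤) ½≤L

  -- The limit is written `+ a / 1 - 1ℚ` to match the sequence of `fromℕ (α G) -ℝ 1ℝ`, with `a` a
  -- variable so that its equation can be matched with `refl`. The summand `½ * δ` provides the gap
  -- that `_<ℝ_` asks for.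
  polynomial-growth : ∀ (A : ℕ → ℕ) {a} p → a ≡ suc p →
    (∀ e → ∃ λ K → ∀ k → K ℕ.≤ k → k ℕ.^ (p ℕ.* e) ℕ.≤ A k ℕ.^ e ℕ.* k) →
    (∀ e → ∃ λ K → ∀ k → K ℕ.≤ k → 1 ℕ.≤ k → A k ℕ.^ e ℕ.≤ k ℕ.^ (2 ℕ.+ p ℕ.* e)) →
    ∀ δ → 0ℚ < δ → ∃ λ K → ∃ λ J → ∀ k → K ℕ.≤ k → 1 ℕ.< k → ∀ j → J ℕ.≤ j →
    ℚ.∣ logSeq (A k) j * recip (logSeq k j) - (+ a / 1 - 1ℚ) ∣ + ½ * δ ≤ δ
  polynomial-growth A p refl lower upper δ 0<δ =
    -- This keeps the error 3/e within the other half of `δ`.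
    let N , unitN<δ/6 = archimedean (+ 1 / 6 * δ) (*-pos (ℚ.positive⁻¹ (+ 1 / 6)) 0<δ)
        e = suc N
        q = 2 ℕ.+ p ℕ.* e ℕ.+ e
        K₁ , lower-k = lower e
        K₂ , upper-k = upper e
    in K₁ ℕ.⊔ K₂ , q ℕ.+ 1 ℕ.* suc q , λ k K≤k 1<k j J≤j → begin
      ℚ.∣ logSeq (A k) j * recip (logSeq k j) - (+ suc p / 1 - 1ℚ) ∣ + ½ * δ
        ≡⟨ cong (λ P → ℚ.∣ logSeq (A k) j * recip (logSeq k j) - P ∣ + ½ * δ) 1+p-1 ⟩
      ℚ.∣ logSeq (A k) j * recip (logSeq k j) - fromℕℚ p ∣ + ½ * δ
        ≤⟨ ℚ.+-monoˡ-≤ (½ * δ) (log-ratio {A k} p N 1<k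
             (lower-k k (ℕ.m⊔n≤o⇒m≤o K₁ K₂ K≤k))
             (upper-k k (ℕ.m⊔n≤o⇒n≤o K₁ K₂ K≤k) (ℕ.<⇒≤ 1<k)) j J≤j) ⟩
      3ℚ * unit N + ½ * δ
        ≤⟨ ℚ.+-monoˡ-≤ (½ * δ) (ℚ.*-monoˡ-≤-nonNeg 3ℚ (ℚ.<⇒≤ unitN<δ/6)) ⟩
      3ℚ * (+ 1 / 6 * δ) + ½ * δ
        ≡⟨ solve 1 (λ δ → con 3ℚ :* (con (+ 1 / 6) :* δ) :+ con ½ :* δ := δ) refl δ ⟩
      δ ∎
    where
    1+p-1 : + suc p / 1 - 1ℚ ≡ fromℕℚ p
    1+p-1 = trans
      (cong (_- 1ℚ) (trans (ℚ.normalize-coprime (Coprime.sym (Coprime.1-coprimeTo (suc p)))) (sym (fromℕℚ-mkℚ (suc p)))))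
      (solve 1 (λ P → P :+ con 1ℚ :- con 1ℚ := P) refl (fromℕℚ p))

open import Data.Nat
open import Data.Nat.Properties
open import Algebra.Properties.CommutativeMonoid.Sum +-0-commutativeMonoid
  using (sum; sum-cong-≗; ∑-distrib-+; ∑-comm; sum-replicate-zero)
open ≤-Reasoning

-- Counting configurations

-- The mean value bound for the power n+1 on the interval from m to m+1, with the derivative taken
-- at the right end, where it is largest.
[1+m]^[1+n]-bound : ∀ m n → suc m ^ suc n ≤ m ^ suc n + suc n * suc m ^ n
[1+m]^[1+n]-bound m zero    = ≤-reflexive (+-comm 1 (m * 1))
[1+m]^[1+n]-bound m (suc n) = begin
  suc m * suc m ^ suc n                                ≡⟨ +-comm (suc m ^ suc n) _ ⟩
  m * suc m ^ suc n + suc m ^ suc n                    ≤⟨ +-monoˡ-≤ _ (*-monoʳ-≤ m ([1+m]^[1+n]-bound m n)) ⟩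
  m * (m ^ suc n + suc n * suc m ^ n) + suc m ^ suc n  ≡⟨ expand m (m ^ suc n) n (suc m ^ n) (suc m ^ suc n) ⟩
  m ^ suc (suc n) + (suc n * (m * suc m ^ n) + suc m ^ suc n)
    ≤⟨ +-monoʳ-≤ (m ^ suc (suc n)) (+-monoˡ-≤ _ (*-monoʳ-≤ (suc n) (*-monoˡ-≤ (suc m ^ n) (n≤1+n m)))) ⟩
  m ^ suc (suc n) + (suc n * suc m ^ suc n + suc m ^ suc n)
    ≡⟨ cong (m ^ suc (suc n) +_) (+-comm (suc n * suc m ^ suc n) _) ⟩
  m ^ suc (suc n) + suc (suc n) * suc m ^ suc n        ∎
  where
  expand : ∀ m x n y z → m * (x + suc n * y) + z ≡ m * x + (suc n * (m * y) + z)
  expand = solve-∀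

-- `#Configurations (suc n) k` is the binomial coefficient C(n+k, n), so the right side is the
-- product (k+1)...(k+n). The induction follows Pascal's recursion, with the mean value bound
-- controlling the increment of the power.
#Configurations-lower : ∀ n k → k ^ n ≤ n ! * #Configurations (suc n) k
#Configurations-lower zero    zero    = ≤-refl
#Configurations-lower zero    (suc k) = #Configurations-lower zero k
#Configurations-lower (suc n) zero    = z≤n
#Configurations-lower (suc n) (suc k) = begin
  suc k ^ suc n                            ≤⟨ [1+m]^[1+n]-bound k n ⟩
  k ^ suc n + suc n * suc k ^ n            ≤⟨ +-mono-≤ (#Configurations-lower (suc n) k)
                                                (*-monoʳ-≤ (suc n) (#Configurations-lower n (suc k))) ⟩
  suc n ! * y + suc n * (n ! * x)          ≡⟨ collect n (n !) x y ⟩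
  suc n ! * (x + y)                        ∎
  where
  x = #Configurations (suc n) (suc k)
  y = #Configurations (suc (suc n)) k
  collect : ∀ n c x y → (suc n * c) * y + suc n * (c * x) ≡ (suc n * c) * (x + y)
  collect = solve-∀

#Configurations-upper : ∀ n k → #Configurations (suc n) k ≤ suc k ^ n
#Configurations-upper zero    zero    = ≤-refl
#Configurations-upper zero    (suc k) = #Configurations-upper zero k
#Configurations-upper (suc n) zero    = ≤-trans (#Configurations-upper n 0) (≤-reflexive (sym (+-identityʳ _)))
#Configurations-upper (suc n) (suc k) = begin
  #Configurations (suc n) (suc k) + #Configurations (suc (suc n)) k
    ≤⟨ +-mono-≤ (#Configurations-upper n (suc k)) (#Configurations-upper (suc n) k) ⟩
  suc (suc k) ^ n + suc k * suc k ^ n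
    ≤⟨ +-monoʳ-≤ (suc (suc k) ^ n) (*-monoʳ-≤ (suc k) (^-monoˡ-≤ n (n≤1+n (suc k)))) ⟩
  suc (suc k) ^ suc n ∎

-- Class i is the interval [first i, first (1+i)), of length 1 + ⌊first i / N⌋.
module Classes (N : ℕ) .{{_ : NonZero N}} where

  first : ℕ → ℕ
  first zero    = 0
  first (suc i) = suc (first i + first i / N)

  -- The intervals are consecutive and nonempty, so the class grows by at most one from `x` to
  -- `suc x` and a single comparison decides it.
  class : ℕ → ℕ
  class zero = 0
  class (suc x) with first (suc (class x)) ≤? suc x
  ... | yes _ = suc (class x)
  ... | no  _ = class x

  first<first : ∀ i → first i < first (suc i)
  first<first i = s≤s (m≤m+n (first i) _)

  first-mono : ∀ {i j} → i ≤ j → first i ≤ first j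
  first-mono {j = zero}  z≤n = ≤-refl
  first-mono {i} {suc j} i≤1+j with m≤n⇒m<n∨m≡n i≤1+j
  ... | inj₁ i<1+j = ≤-trans (first-mono (s≤s⁻¹ i<1+j)) (<⇒≤ (first<first j))
  ... | inj₂ refl  = ≤-refl

  class-bounds : ∀ x → first (class x) ≤ x × x < first (suc (class x))
  class-bounds zero = z≤n , s≤s z≤n
  class-bounds (suc x) with first (suc (class x)) ≤? suc x
  ... | yes first≤1+x = first≤1+x , <-≤-trans (s≤s (proj₂ (class-bounds x))) (first<first _)
  ... | no  first≰1+x = m≤n⇒m≤1+n (proj₁ (class-bounds x)) , ≰⇒> first≰1+x

  class-mono : ∀ {x y} → x ≤ y → class x ≤ class y
  class-mono {x} {y} x≤y = ≮⇒≥ λ cy<cx → <⇒≱ (proj₂ (class-bounds y))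
    (≤-trans (first-mono cy<cx) (≤-trans (proj₁ (class-bounds x)) x≤y))

  -- Elements of one class differ by at most ⌊s/N⌋, where s is the first element of the class; and s
  -- ≤ z because `z` lies in the same class or a later one.
  class-short : ∀ x y z → class x ≡ class y → class x ≤ class z → N * (x ∸ y) ≤ z
  class-short x y z cx≡cy cx≤cz = begin
    N * (x ∸ y)          ≤⟨ *-monoʳ-≤ N (∸-mono (s≤s⁻¹ (proj₂ (class-bounds x)))
                              (subst (λ i → first i ≤ y) (sym cx≡cy) (proj₁ (class-bounds y)))) ⟩
    N * (s + s / N ∸ s)  ≡⟨ cong (N *_) (m+n∸m≡n s (s / N)) ⟩
    N * (s / N)          ≡⟨ *-comm N (s / N) ⟩
    s / N * N            ≤⟨ m/n*n≤m s N ⟩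
    s                    ≤⟨ first-mono cx≤cz ⟩
    first (class z)      ≤⟨ proj₁ (class-bounds z) ⟩
    z                    ∎
    where
    s = first (class x)

  -- Geometric growth: `suc (first i)` increases at least by the factor 1 + 1/N in each step, so the
  -- number of classes up to k is logarithmic in k.
  first-growth : ∀ i → suc N * suc (first i) ≤ N * suc (first (suc i))
  first-growth i = begin
    suc N * suc s                            ≡⟨ cong (λ t → t + N * suc s) (cong suc (m≡m%n+[m/n]*n s N)) ⟩
    suc (s % N + s / N * N) + N * suc s      ≤⟨ +-monoˡ-≤ (N * suc s) (+-monoˡ-≤ (s / N * N) (m%n<n s N)) ⟩
    N + s / N * N + N * suc s                ≡⟨ collect N (s / N) s ⟩
    N * suc (first (suc i))                  ∎
    where
    s = first i
    collect : ∀ N q s → N + q * N + N * suc s ≡ N * suc (suc (s + q))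
    collect = solve-∀

  -- Geometric growth beats the polynomial C(i+p, p). The left side obeys Pascal's recursion, and by
  -- `first-growth` the right side dominates it: the step needs exactly (N+1) · a ≤ N · b for
  -- consecutive values a, b of `suc ∘ first`.
  #Configurations≤first : ∀ p i → #Configurations (suc p) i ≤ suc N ^ p * suc (first i)
  #Configurations≤first zero    zero    = ≤-refl
  #Configurations≤first zero    (suc i) = ≤-trans (#Configurations≤first zero i)
    (+-monoˡ-≤ 0 (s≤s (<⇒≤ (first<first i))))
  #Configurations≤first (suc p) zero    = ≤-trans (#Configurations≤first p zero)
    (*-monoˡ-≤ 1 (m≤m+n (suc N ^ p) _))
  #Configurations≤first (suc p) (suc i) = begin
    #Configurations (suc p) (suc i) + #Configurations (suc (suc p)) i
      ≤⟨ +-mono-≤ (#Configurations≤first p (suc i)) (#Configurations≤first (suc p) i) ⟩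
    P * b + suc N * P * a      ≡⟨ cong (P * b +_) (regroup N P a) ⟩
    P * b + P * (suc N * a)    ≤⟨ +-monoʳ-≤ (P * b) (*-monoʳ-≤ P (first-growth i)) ⟩
    P * b + P * (N * b)        ≡⟨ collect N P b ⟩
    suc N * P * b              ∎
    where
    P = suc N ^ p
    a = suc (first i)
    b = suc (first (suc i))
    regroup : ∀ N P a → suc N * P * a ≡ P * (suc N * a)
    regroup = solve-∀
    collect : ∀ N P b → P * b + P * (N * b) ≡ suc N * P * b
    collect = solve-∀

  -- The class of k may reach beyond k; this keeps its end within a constant factor of its
  -- beginning.
  first-double : ∀ i → suc (first (suc i)) ≤ 2 * suc (first i)
  first-double i = begin
    suc (suc (s + s / N))    ≤⟨ s≤s (s≤s (+-monoʳ-≤ s (m/n≤m s N))) ⟩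
    suc (suc (s + s))        ≡⟨ double s ⟩
    2 * suc s                ∎
    where
    s = first i
    double : ∀ s → suc (suc (s + s)) ≡ 2 * suc s
    double = solve-∀

  -- The power is compared with C(class k + 1 + p, p), at the price of `p !`; geometric growth costs
  -- `suc N ^ p`, and the overhang of the last class beyond k costs 2.
  class-subpolynomial : ∀ p → ∃ λ c → ∀ k → suc (class k) ^ p ≤ c * suc k
  class-subpolynomial p = p ! * suc N ^ p * 2 , λ k → begin
    suc (class k) ^ p                                    ≤⟨ #Configurations-lower p (suc (class k)) ⟩
    p ! * #Configurations (suc p) (suc (class k))        ≤⟨ *-monoʳ-≤ (p !) (#Configurations≤first p (suc (class k))) ⟩
    p ! * (suc N ^ p * suc (first (suc (class k))))      ≤⟨ *-monoʳ-≤ (p !) (*-monoʳ-≤ (suc N ^ p)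
                                                             (≤-trans (first-double (class k))
                                                               (*-monoʳ-≤ 2 (s≤s (proj₁ (class-bounds k)))))) ⟩
    p ! * (suc N ^ p * (2 * suc k))                      ≡⟨ regroup (p !) (suc N ^ p) (suc k) ⟩
    p ! * suc N ^ p * 2 * suc k                          ∎
    where
    regroup : ∀ a b c → a * (b * (2 * c)) ≡ a * b * 2 * c
    regroup = solve-∀

-- Enumerating subsets

element : ∀ {n} (S : Subset n) → Fin ∣ S ∣ → Fin n
element (inside  ∷ S) zero    = zero
element (inside  ∷ S) (suc i) = suc (element S i)
element (outside ∷ S) i       = suc (element S i)

element-∈ : ∀ {n} (S : Subset n) i → element S i ∈ S
element-∈ (inside  ∷ S) zero    = Vec.here
element-∈ (inside  ∷ S) (suc i) = Vec.there (element-∈ S i)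
element-∈ (outside ∷ S) i       = Vec.there (element-∈ S i)

element-injective : ∀ {n} (S : Subset n) {i j} → element S i ≡ element S j → i ≡ j
element-injective (inside  ∷ S) {zero}  {zero}  eq = refl
element-injective (inside  ∷ S) {suc i} {suc j} eq = cong suc (element-injective S (Fin.suc-injective eq))
element-injective (outside ∷ S) eq = element-injective S (Fin.suc-injective eq)

rank : ∀ {n} (S : Subset n) {i} → i ∈ S → ∃ λ r → element S r ≡ i
rank (inside  ∷ S) Vec.here        = zero , refl
rank (inside  ∷ S) (Vec.there i∈S) = let r , eq = rank S i∈S in suc r , cong suc eq
rank (outside ∷ S) (Vec.there i∈S) = let r , eq = rank S i∈S in r , cong suc eq

-- Bounds on the independence number, and greedy independent sets

module _ (H : FiniteGraph) where
  open FiniteGraph H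

  index-vertex : ∀ i → index (vertex i) ≡ i
  index-vertex i = Inverse.inverseʳ numbering refl

  vertex-index : ∀ v → vertex (index v) ≡ v
  vertex-index v = Inverse.inverseˡ numbering refl

  vertex-injective : ∀ {i j} → vertex i ≡ vertex j → i ≡ j
  vertex-injective eq = trans (sym (index-vertex _)) (trans (cong index eq) (index-vertex _))

  index-injective : ∀ {u v} → index u ≡ index v → u ≡ v
  index-injective eq = trans (sym (vertex-index _)) (trans (cong vertex eq) (vertex-index _))

  -- Independent sets are bit vectors, so the image of `f` is encoded as one; `rank` then embeds
  -- `Fin m` into the positions of its elements.
  nonadjacent-family : ∀ {m} (f : Fin m → Vertex) → (∀ {i j} → f i ≡ f j → i ≡ j) →
                       (∀ i j → ¬ Adj (f i) (f j)) → m ≤ α H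
  nonadjacent-family f f-inj nonadj =
    ≤-trans (Fin.injective⇒≤ {f = proj₁ ∘ r} r-injective)
      (proj₂ (proj₂ independenceNumber) S independent)
    where
    image? = λ i → Fin.any? λ m → index (f m) Fin.≟ i
    S = tabulate (does ∘ image?)

    ∈S : ∀ m → index (f m) ∈ S
    ∈S m = Vec.lookup⇒[]= _ S (trans (Vec.lookup∘tabulate (does ∘ image?) _)
      (dec-true (image? (index (f m))) (m , refl)))

    S∋ : ∀ {i} → i ∈ S → ∃ λ m → index (f m) ≡ i
    S∋ {i} i∈S with image? i | trans (sym (Vec.lookup∘tabulate (does ∘ image?) i)) (Vec.[]=⇒lookup i∈S)
    ... | yes found | _ = found
    ... | no  _     | ()

    independent : Independent S
    independent i j i∈S j∈S with S∋ i∈S | S∋ j∈S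
    ... | a , refl | b , refl =
      λ adj → nonadj a b (subst₂ Adj (vertex-index (f a)) (vertex-index (f b)) adj)

    r = λ m → rank S (∈S m)

    r-injective : ∀ {a b} → proj₁ (r a) ≡ proj₁ (r b) → a ≡ b
    r-injective {a} {b} eq = f-inj (index-injective
      (trans (sym (proj₂ (r a))) (trans (cong (element S) eq) (proj₂ (r b)))))

  -- The fibres of `code` are cliques and meet an independent set at most once, so `code` is
  -- injective on a maximum independent set.
  clique-cover : ∀ {m} (code : Vertex → Fin m) →
                 (∀ u v → code u ≡ code v → u ≢ v → Adj u v) → α H ≤ m
  clique-cover code clique with independenceNumber
  ... | a , (S , ind , refl) , _ = Fin.injective⇒≤ injective
    where
    injective : ∀ {i j} → code (vertex (element S i)) ≡ code (vertex (element S j)) → i ≡ j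
    injective {i} {j} eq with vertex (element S i) ≟ᵛ vertex (element S j)
      where _≟ᵛ_ = FiniteGraph._≟_ H
    ... | yes same = element-injective S (vertex-injective same)
    ... | no  diff = contradiction (clique _ _ eq diff)
                       (ind _ _ (element-∈ S i) (element-∈ S j))

  -- Scanning the vertices by decreasing priority, M takes every vertex without a neighbour in M.
  greedy : (s : Fin order → ℕ) → ∃ λ M → Independent M × ∃ λ (c : Fin order → Fin order) →
           ∀ u → c u ∈ M × s u ≤ s (c u) × (vertex u ≡ vertex (c u) ⊎ Adj (vertex u) (vertex (c u)))
  greedy s =
    let M , ind , _ , centre = scan (sort (List.allFin order))
                                 (Sorted.Sorted⇒AllPairs totalOrder (sort-↗ (List.allFin order)))
        c = λ u → centre u (∈-resp-↭ (↭-sym (sort-↭ (List.allFin order))) (∈-allFin u))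
    in M , ind , proj₁ ∘ c , proj₂ ∘ c
    where
    byPriority = On.decTotalOrder ≤-decTotalOrder s
    open DecTotalOrder byPriority using (totalOrder)
    open Sort byPriority using (sort; sort-↗; sort-↭)

    Centre : Subset order → Fin order → Fin order → Set
    Centre M u w = w ∈ M × s u ≤ s w × (vertex u ≡ vertex w ⊎ Adj (vertex u) (vertex w))

    scan : ∀ us → AllPairs (λ u v → s u ≤ s v) us →
           ∃ λ M → Independent M × (∀ {w} → w ∈ M → w ∈ˡ us) × (∀ u → u ∈ˡ us → ∃ (Centre M u))
    scan [] [] = ⊥ , (λ _ _ i∈⊥ → contradiction i∈⊥ ∉⊥) , (λ w∈⊥ → contradiction w∈⊥ ∉⊥) , λ _ ()
    -- The list increases in priority and its tail is scanned first, so every vertex already in `M`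
    -- has at least the priority of `v`.
    scan (v ∷ us) (v≤us ∷ sorted) with scan us sorted
    ... | M , ind , M⊆us , centre
      with Fin.any? (λ w → (w ∈? M) ×-dec Adj? (vertex v) (vertex w))
    ...   | yes (w , w∈M , v~w) = M , ind , there ∘ M⊆us , λ where
            u (here refl)  → w , w∈M , All.lookup v≤us (M⊆us w∈M) , inj₂ v~w
            u (there u∈us) → centre u u∈us
    ...   | no none = M ∪ ⁅ v ⁆ , ind′ , M′⊆ , λ where
            u (here refl)  → v , x∈p∪q⁺ {p = M} (inj₂ (x∈⁅x⁆ v)) , ≤-refl , inj₁ refl
            u (there u∈us) → let w , w∈M , rest = centre u u∈us in w , x∈p∪q⁺ (inj₁ w∈M) , rest
      where
      M′⊆ : ∀ {w} → w ∈ M ∪ ⁅ v ⁆ → w ∈ˡ v ∷ us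
      M′⊆ w∈ with x∈p∪q⁻ M ⁅ v ⁆ w∈
      ... | inj₁ w∈M = there (M⊆us w∈M)
      ... | inj₂ w∈v = here (x∈⁅y⁆⇒x≡y v w∈v)

      ind′ : Independent (M ∪ ⁅ v ⁆)
      ind′ i j i∈ j∈ adj with x∈p∪q⁻ M ⁅ v ⁆ i∈ | x∈p∪q⁻ M ⁅ v ⁆ j∈
      ... | inj₁ i∈M | inj₁ j∈M = ind i j i∈M j∈M adj
      ... | inj₁ i∈M | inj₂ j∈v with refl ← x∈⁅y⁆⇒x≡y v j∈v = none (i , i∈M , Adj-sym adj)
      ... | inj₂ i∈v | inj₁ j∈M with refl ← x∈⁅y⁆⇒x≡y v i∈v = none (j , j∈M , adj)
      ... | inj₂ i∈v | inj₂ j∈v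
        with refl ← x∈⁅y⁆⇒x≡y v i∈v | refl ← x∈⁅y⁆⇒x≡y v j∈v = Adj-irrefl adj

-- Configurations supported on a subset

spread : ∀ {n} (S : Subset n) → Vec ℕ ∣ S ∣ → Vec ℕ n
spread []            []       = []
spread (inside  ∷ S) (x ∷ xs) = x ∷ spread S xs
spread (outside ∷ S) xs       = 0 ∷ spread S xs

sum-spread : ∀ {n} (S : Subset n) xs → Vec.sum (spread S xs) ≡ Vec.sum xs
sum-spread []            []       = refl
sum-spread (inside  ∷ S) (x ∷ xs) = cong (x +_) (sum-spread S xs)
sum-spread (outside ∷ S) xs       = sum-spread S xs

spread-injective : ∀ {n} (S : Subset n) {xs ys} → spread S xs ≡ spread S ys → xs ≡ ys
spread-injective []            {[]}     {[]}     eq = refl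
spread-injective (inside  ∷ S) {x ∷ xs} {y ∷ ys} eq =
  cong₂ _∷_ (Vec.∷-injectiveˡ eq) (spread-injective S (Vec.∷-injectiveʳ eq))
spread-injective (outside ∷ S) eq = spread-injective S (Vec.∷-injectiveʳ eq)

spread-support : ∀ {n} (S : Subset n) xs i → lookup (spread S xs) i ≢ 0 → i ∈ S
spread-support (inside  ∷ S) (x ∷ xs) zero    ≢0 = Vec.here
spread-support (inside  ∷ S) (x ∷ xs) (suc i) ≢0 = Vec.there (spread-support S xs i ≢0)
spread-support (outside ∷ S) xs       zero    ≢0 = contradiction refl ≢0
spread-support (outside ∷ S) xs       (suc i) ≢0 = Vec.there (spread-support S xs i ≢0)

-- The coordinates in `S` are padded with zeros to length `a`: greedy sets vary in size, and all
-- their star totals are to be counted in the same `Configuration a k`.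
squeeze : ∀ {n} (S : Subset n) a → ∣ S ∣ ≤ a → Vec ℕ n → Vec ℕ a
squeeze []            a       _           []       = Vec.replicate a 0
squeeze (inside  ∷ S) (suc a) (s≤s ∣S∣≤a) (x ∷ xs) = x ∷ squeeze S a ∣S∣≤a xs
squeeze (outside ∷ S) a       ∣S∣≤a       (x ∷ xs) = squeeze S a ∣S∣≤a xs

Supported : ∀ {n} → Subset n → Vec ℕ n → Set
Supported S xs = ∀ i → i ∉ S → lookup xs i ≡ 0

Supported-tail : ∀ {n} b (S : Subset n) x xs → Supported (b ∷ S) (x ∷ xs) → Supported S xs
Supported-tail b S x xs supp i i∉S = supp (suc i) (i∉S ∘ drop-there)

sum-squeeze : ∀ {n} (S : Subset n) a le xs → Supported S xs → Vec.sum (squeeze S a le xs) ≡ Vec.sum xs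
sum-squeeze []            zero    le       []       _    = refl
sum-squeeze []            (suc a) le       []       supp = sum-squeeze [] a z≤n [] supp
sum-squeeze (inside  ∷ S) (suc a) (s≤s le) (x ∷ xs) supp =
  cong (x +_) (sum-squeeze S a le xs (Supported-tail inside S x xs supp))
sum-squeeze (outside ∷ S) a       le       (x ∷ xs) supp =
  cong₂ _+_ (sym (supp zero λ ())) (sum-squeeze S a le xs (Supported-tail outside S x xs supp))

squeeze-injective : ∀ {n} (S : Subset n) a le xs ys → Supported S xs → Supported S ys →
                    squeeze S a le xs ≡ squeeze S a le ys → xs ≡ ys
squeeze-injective []            a       le       []       []       _  _  eq = refl
squeeze-injective (inside  ∷ S) (suc a) (s≤s le) (x ∷ xs) (y ∷ ys) sx sy eq = cong₂ _∷_
  (Vec.∷-injectiveˡ eq)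
  (squeeze-injective S a le xs ys (Supported-tail inside S x xs sx) (Supported-tail inside S y ys sy)
    (Vec.∷-injectiveʳ eq))
squeeze-injective (outside ∷ S) a       le       (x ∷ xs) (y ∷ ys) sx sy eq = cong₂ _∷_
  (trans (sx zero λ ()) (sym (sy zero λ ())))
  (squeeze-injective S a le xs ys (Supported-tail outside S x xs sx) (Supported-tail outside S y ys sy) eq)

lookup-injective : ∀ {n} {xs ys : Vec ℕ n} → lookup xs ≗ lookup ys → xs ≡ ys
lookup-injective {xs = xs} {ys} eq =
  trans (sym (Vec.tabulate∘lookup xs)) (trans (Vec.tabulate-cong eq) (Vec.tabulate∘lookup ys))

numbering-injective : ∀ n k {i j} → Inverse.to (Configuration-numbering n k) i ≡
                      Inverse.to (Configuration-numbering n k) j → i ≡ j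
numbering-injective n k eq = trans (sym (Inverse.strictlyInverseʳ (Configuration-numbering n k) _))
  (trans (cong (Inverse.from (Configuration-numbering n k)) eq)
    (Inverse.strictlyInverseʳ (Configuration-numbering n k) _))

-- The lower bound for the independence number of G[k]

α[G[k]]-lower : ∀ G k → #Configurations (α G) k ≤ α (G [ k ])
α[G[k]]-lower G k with FiniteGraph.independenceNumber G
... | _ , (S , ind , refl) , _ = nonadjacent-family (G [ k ]) config config-injective nonadjacent
  where
  open FiniteGraph G
  open Pebbles G k using (preimage; Places; Move)

  coordinates = Inverse.to (Configuration-numbering ∣ S ∣ k)

  config : Fin (#Configurations ∣ S ∣ k) → Configuration order k
  config m = let xs , eq = coordinates m in spread S xs , trans (sum-spread S xs) eq

  config-injective : ∀ {i j} → config i ≡ config j → i ≡ j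
  config-injective eq = numbering-injective ∣ S ∣ k
    (Configuration-≡ (spread-injective S (cong proj₁ eq)))

  occupied : ∀ φ f → Places φ f → ∀ i → lookup (proj₁ f) (index (φ i)) ≢ 0
  -- Pebble `i` belongs to the preimage of its own place; if that place were empty, its rank would
  -- be an element of `Fin 0`.
  occupied φ f p i empty with subst Fin (trans (p (φ i)) empty) (proj₁ (rank (preimage φ (φ i)) i∈))
    where
    i∈ : i ∈ preimage φ (φ i)
    i∈ = Vec.lookup⇒[]= i _ (trans (Vec.lookup∘tabulate _ i) (dec-true (φ i ≟ᵛ φ i) refl))
      where _≟ᵛ_ = FiniteGraph._≟_ G
  ... | ()

  nonadjacent : ∀ i j → ¬ FiniteGraph.Adj (G [ k ]) (config i) (config j)
  nonadjacent a b (f≢g , φ , γ , p , q , steps) = f≢g (Configuration-≡ (lookup-injective same))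
    where
    φ≗γ : φ ≗ γ
    φ≗γ i with steps i
    ... | inj₁ eq = eq
    ... | inj₂ adj = contradiction
      (subst₂ Adj (sym (vertex-index G (φ i))) (sym (vertex-index G (γ i))) adj)
      (ind _ _ (spread-support S _ _ (occupied φ (config a) p i))
               (spread-support S _ _ (occupied γ (config b) q i)))

    same : lookup (proj₁ (config a)) ≗ lookup (proj₁ (config b))
    same i = subst (λ w → lookup (proj₁ (config a)) w ≡ lookup (proj₁ (config b)) w)
      (index-vertex G i)
      (trans (sym (p (vertex i)))
        (trans (cong ∣_∣ (Vec.tabulate-cong λ l → cong (λ w → does (FiniteGraph._≟_ G w (vertex i))) (φ≗γ l)))
          (q (vertex i))))

-- Transporting functions on Fin

at : ∀ {n} → Fin n → ℕ → Fin n → ℕ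
at u x w = if does (u Fin.≟ w) then x else 0

at-+ : ∀ {n} (u : Fin n) x y w → at u (x + y) w ≡ at u x w + at u y w
at-+ u x y w with does (u Fin.≟ w)
... | true  = refl
... | false = refl

at-0 : ∀ {n} (u : Fin n) w → at u 0 w ≡ 0
at-0 u w with does (u Fin.≟ w)
... | true  = refl
... | false = refl

sum-at : ∀ {n} (u : Fin n) x → sum (at u x) ≡ x
sum-at {suc n} zero    x = trans (cong (x +_) (sum-replicate-zero n)) (+-identityʳ x)
sum-at         (suc u) x = sum-at u x

-- The pushforward of `f` along `c`, that is, its sums over the fibres. When `c` sends vertices to
-- their centres, these are the star totals.
push : ∀ {t n} → (Fin t → Fin n) → (Fin t → ℕ) → Fin n → ℕ
push c f w = sum λ j → at (c j) (f j) w

sum-push : ∀ {t n} (c : Fin t → Fin n) f → sum (push c f) ≡ sum f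
sum-push c f = trans (sym (∑-comm λ j w → at (c j) (f j) w)) (sum-cong-≗ λ j → sum-at (c j) (f j))

push-cong : ∀ {t n} (c : Fin t → Fin n) {f g} → f ≗ g → push c f ≗ push c g
push-cong c f≗g w = sum-cong-≗ λ j → cong (λ x → at (c j) x w) (f≗g j)

push-+ : ∀ {t n} (c : Fin t → Fin n) f g w →
         push c (λ j → f j + g j) w ≡ push c f w + push c g w
push-+ c f g w = trans (sum-cong-≗ λ j → at-+ (c j) (f j) (g j) w)
  (∑-distrib-+ (λ j → at (c j) (f j) w) (λ j → at (c j) (g j) w))

push-id : ∀ {n} (f : Fin n → ℕ) → push id f ≗ f
push-id {suc n} f zero    = trans (cong (f zero +_) (sum-replicate-zero n)) (+-identityʳ (f zero))
push-id         f (suc w) = push-id (f ∘ suc) w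

-- A fibre has at most `t` elements, and the bound is asked only on the fibre over `w`. Keeping the
-- factor `N` on the left avoids division.
push-bound : ∀ {t n} N b (c : Fin t → Fin n) f w → (∀ j → c j ≡ w → N * f j ≤ b) →
             N * push c f w ≤ t * b
push-bound {zero}  N b c f w bound = ≤-reflexive (*-zeroʳ N)
push-bound {suc t} N b c f w bound = begin
  N * (at (c zero) (f zero) w + push (c ∘ suc) (f ∘ suc) w)  ≡⟨ *-distribˡ-+ N _ _ ⟩
  N * at (c zero) (f zero) w + N * push (c ∘ suc) (f ∘ suc) w
    ≤⟨ +-mono-≤ first-bound (push-bound N b (c ∘ suc) (f ∘ suc) w (bound ∘ suc)) ⟩
  b + t * b ∎
  where
  first-bound : N * at (c zero) (f zero) w ≤ b
  first-bound with c zero Fin.≟ w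
  ... | yes c₀≡w = bound zero c₀≡w
  ... | no  _    = ≤-trans (≤-reflexive (*-zeroʳ N)) z≤n

push-outside : ∀ {t n} (c : Fin t → Fin n) f w → (∀ j → c j ≢ w) → push c f w ≡ 0
push-outside {t} c f w c≢w = n≤0⇒n≡0 (≤-trans (≤-reflexive (sym (*-identityˡ _)))
  (≤-trans (push-bound 1 0 c f w (λ j eq → contradiction eq (c≢w j))) (≤-reflexive (*-zeroʳ t))))

-- Moves from transport plans

module Coupling (G : FiniteGraph) where
  open FiniteGraph G

  _⇝_ : Fin order → Fin order → Set
  i ⇝ j = vertex i ≡ vertex j ⊎ Adj (vertex i) (vertex j)

  Counts : ∀ k → (Fin k → Vertex) → (Fin order → ℕ) → Set
  Counts k φ f = ∀ v → ∣ Pebbles.preimage G k φ v ∣ ≡ f (index v)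

  -- A `Move` between arbitrary count functions: the number of pebbles may vary, so a move can be
  -- assembled from small batches.
  record Coupled (k : ℕ) (f g : Fin order → ℕ) : Set where
    constructor coupled
    field
      {from to}  : Fin k → Vertex
      fromCounts : Counts k from f
      toCounts   : Counts k to g
      steps      : Pebbles.Steps G k from to

  Coupled-resp : ∀ {k f f′ g g′} → f ≗ f′ → g ≗ g′ → Coupled k f g → Coupled k f′ g′
  Coupled-resp f≗f′ g≗g′ (coupled p q s) =
    coupled (λ v → trans (p v) (f≗f′ _)) (λ v → trans (q v) (g≗g′ _)) s

  Coupled-size : ∀ {k l f g} → k ≡ l → Coupled k f g → Coupled l f g
  Coupled-size refl c = c

  prepend : ∀ {k} → Vertex → (Fin k → Vertex) → Fin (suc k) → Vertex
  prepend v φ zero    = v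
  prepend v φ (suc i) = φ i

  Counts-prepend : ∀ {k} i φ f → Counts k φ f →
                   Counts (suc k) (prepend (vertex i) φ) (λ w → at i 1 w + f w)
  Counts-prepend i φ f p v rewrite index-vertex G i with does (i Fin.≟ index v)
  ... | true  = cong suc (p v)
  ... | false = p v

  couple : ∀ {i j} → i ⇝ j → ∀ m {k f g} → Coupled k f g →
           Coupled (m + k) (λ w → at i m w + f w) (λ w → at j m w + g w)
  couple {i} {j} i⇝j zero {k} {f} {g} c = Coupled-resp
    (λ w → cong (_+ f w) (sym (at-0 i w))) (λ w → cong (_+ g w) (sym (at-0 j w))) c
  couple {i} {j} i⇝j (suc m) {k} {f} {g} c with couple i⇝j m c
  ... | coupled {φ} {γ} p q s = Coupled-resp (regroup i f) (regroup j g)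
    (coupled {from = prepend (vertex i) φ} {to = prepend (vertex j) γ}
      (Counts-prepend i φ (λ w → at i m w + f w) p)
      (Counts-prepend j γ (λ w → at j m w + g w) q)
      λ { zero → i⇝j ; (suc l) → s l })
    where
    regroup : ∀ u h w → at u 1 w + (at u m w + h w) ≡ at u (suc m) w + h w
    regroup u h w = trans (sym (+-assoc (at u 1 w) (at u m w) (h w)))
      (cong (_+ h w) (sym (at-+ u 1 m w)))

  -- A transport plan with route `a j ⇝ b j` and load `m j`; its two marginals are the pushforwards
  -- of the loads along `a` and `b`.
  coupleAll : ∀ {t} (a b : Fin t → Fin order) → (∀ j → a j ⇝ b j) → ∀ m {k f g} → Coupled k f g →
              Coupled (sum m + k) (λ w → push a m w + f w) (λ w → push b m w + g w)
  coupleAll {zero}  a b a⇝b m c = c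
  coupleAll {suc t} a b a⇝b m {k} {f} {g} c = Coupled-resp (assoc a f) (assoc b g)
    (Coupled-size (sym (+-assoc (m zero) (sum (m ∘ suc)) k))
      (couple (a⇝b zero) (m zero) (coupleAll (a ∘ suc) (b ∘ suc) (a⇝b ∘ suc) (m ∘ suc) c)))
    where
    assoc : ∀ u h w → at (u zero) (m zero) w + (push (u ∘ suc) (m ∘ suc) w + h w) ≡ push u m w + h w
    assoc u h w = sym (+-assoc (at (u zero) (m zero) w) (push (u ∘ suc) (m ∘ suc) w) (h w))

  none : Coupled 0 (λ _ → 0) (λ _ → 0)
  none = coupled {from = λ ()} {to = λ ()} (λ _ → refl) (λ _ → refl) (λ ())

  -- Each u sends its surplus f u ∸ g u to its centre c u, which returns the deficit g u ∸ f u.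
  star-coupling : ∀ f g (c : Fin order → Fin order) → (∀ u → u ⇝ c u) →
                  (∀ u → (f u ∸ g u) + push c (λ v → g v ∸ f v) u ≤ f u) →
                  push c f ≗ push c g → Coupled (sum f) f g
  star-coupling f g c star enough totals = Coupled-size total
    (Coupled-resp left right
      (coupleAll c id (λ u → flip (star u)) y
        (coupleAll id c star x
          (coupleAll id id (λ _ → inj₁ refl) z none))))
    where
    flip : ∀ {u v} → u ⇝ v → v ⇝ u
    flip (inj₁ eq)  = inj₁ (sym eq)
    flip (inj₂ adj) = inj₂ (Adj-sym adj)

    x y z : Fin order → ℕ
    x u = f u ∸ g u
    y u = g u ∸ f u
    -- The pebbles that stay; `enough` makes the truncated subtraction exact.
    z u = f u ∸ (x u + push c y u)

    left : ∀ w → push c y w + (push id x w + (push id z w + 0)) ≡ f w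
    left w = begin-equality
      push c y w + (push id x w + (push id z w + 0))
        ≡⟨ cong₂ (λ a b → push c y w + (a + b)) (push-id x w) (trans (+-identityʳ _) (push-id z w)) ⟩
      push c y w + (x w + z w)
        ≡⟨ +-assoc (push c y w) (x w) (z w) ⟨
      push c y w + x w + z w
        ≡⟨ cong (_+ z w) (+-comm (push c y w) (x w)) ⟩
      x w + push c y w + z w
        ≡⟨ m+[n∸m]≡n (enough w) ⟩
      f w ∎

    balance : ∀ u → f u + y u ≡ g u + x u
    balance u = trans (m+[n∸m]≡m⊔n (f u) (g u)) (trans (⊔-comm (f u) (g u)) (sym (m+[n∸m]≡m⊔n (g u) (f u))))
      where
      m+[n∸m]≡m⊔n : ∀ m n → m + (n ∸ m) ≡ m ⊔ n
      m+[n∸m]≡m⊔n m n with ≤-total m n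
      ... | inj₁ m≤n = trans (m+[n∸m]≡n m≤n) (sym (m≤n⇒m⊔n≡n m≤n))
      ... | inj₂ n≤m = trans (cong (m +_) (m≤n⇒m∸n≡0 n≤m)) (trans (+-identityʳ m) (sym (m≥n⇒m⊔n≡m n≤m)))

    -- In each star the surpluses balance the deficits: push `balance` forward and cancel the equal
    -- star totals of `f` and `g`.
    exchange : ∀ w → push c x w ≡ push c y w
    exchange w = +-cancelˡ-≡ (push c g w) _ _ (begin-equality
      push c g w + push c x w        ≡⟨ push-+ c g x w ⟨
      push c (λ u → g u + x u) w     ≡⟨ push-cong c balance w ⟨
      push c (λ u → f u + y u) w     ≡⟨ push-+ c f y w ⟩
      push c f w + push c y w        ≡⟨ cong (_+ push c y w) (totals w) ⟩
      push c g w + push c y w        ∎)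

    -- After adding `x w`, `exchange` turns the arrivals into the departures plus `y w`, so `left`
    -- and `balance` give the result.
    right : ∀ w → push id y w + (push c x w + (push id z w + 0)) ≡ g w
    right w = +-cancelʳ-≡ (x w) _ _ (begin-equality
      push id y w + (push c x w + (push id z w + 0)) + x w
        ≡⟨ cong₂ (λ a b → a + (b + (push id z w + 0)) + x w) (push-id y w) (exchange w) ⟩
      y w + (push c y w + (push id z w + 0)) + x w
        ≡⟨ shuffle (y w) (push c y w) (push id z w + 0) (x w) ⟩
      push c y w + (x w + (push id z w + 0)) + y w
        ≡⟨ cong (λ a → push c y w + (a + (push id z w + 0)) + y w) (push-id x w) ⟨
      push c y w + (push id x w + (push id z w + 0)) + y w
        ≡⟨ cong (_+ y w) (left w) ⟩
      f w + y w
        ≡⟨ balance w ⟩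
      g w + x w ∎)
      where
      shuffle : ∀ a b c d → a + (b + c) + d ≡ b + (d + c) + a
      shuffle = solve-∀

    total : sum y + (sum x + (sum z + 0)) ≡ sum f
    total = begin-equality
      sum y + (sum x + (sum z + 0))
        ≡⟨ cong₂ _+_ (sym (sum-push c y)) (cong₂ _+_ (sym (sum-push id x))
             (cong₂ _+_ (sym (sum-push id z)) (sym (sum-replicate-zero order)))) ⟩
      sum (push c y) + (sum (push id x) + (sum (push id z) + sum {order} λ _ → 0))
        ≡⟨ cong (λ s → sum (push c y) + (sum (push id x) + s)) (∑-distrib-+ (push id z) (λ _ → 0)) ⟨
      sum (push c y) + (sum (push id x) + sum (λ w → push id z w + 0))
        ≡⟨ cong (sum (push c y) +_) (∑-distrib-+ (push id x) (λ w → push id z w + 0)) ⟨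
      sum (push c y) + sum (λ w → push id x w + (push id z w + 0))
        ≡⟨ ∑-distrib-+ (push c y) (λ w → push id x w + (push id z w + 0)) ⟨
      sum (λ w → push c y w + (push id x w + (push id z w + 0)))
        ≡⟨ sum-cong-≗ left ⟩
      sum f ∎

-- Covering G [ k ] by cliques

lookup≤sum : ∀ {n} (xs : Vec ℕ n) i → lookup xs i ≤ Vec.sum xs
lookup≤sum (x ∷ xs) zero    = m≤m+n x _
lookup≤sum (x ∷ xs) (suc i) = ≤-trans (lookup≤sum xs i) (m≤n+m _ x)

sum-tabulate : ∀ {n} (f : Fin n → ℕ) → Vec.sum (tabulate f) ≡ sum f
sum-tabulate {zero}  f = refl
sum-tabulate {suc n} f = cong (f zero +_) (sum-tabulate (f ∘ suc))

module CliqueCover (G : FiniteGraph) (k : ℕ) where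
  open FiniteGraph G
  -- A centre's value is cut into `suc order` shares: one covers its own surplus, the others the
  -- deficits of the at most `order` vertices of its star.
  open Classes (suc order)
  open Coupling G

  Classification = Fin (suc (class k) ^ order)

  classAt : Classification → Fin order → ℕ
  classAt κ = toℕ ∘ finToFun κ

  classify : Configuration order k → Classification
  classify (f , sum≡k) = funToFin λ i →
    fromℕ< (s≤s (class-mono (≤-trans (lookup≤sum f i) (≤-reflexive sum≡k))))

  classAt-classify : ∀ f i → classAt (classify f) i ≡ class (lookup (proj₁ f) i)
  classAt-classify f i = trans (cong toℕ (Fin.finToFun-funToFin _ i)) (Fin.toℕ-fromℕ< _)

  -- The stars are built from the classes alone, so configurations with the same classification have
  -- the same stars and their totals can be compared.
  module _ (κ : Classification) where
    centres : Subset order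
    centres = proj₁ (greedy G (classAt κ))

    centre : Fin order → Fin order
    centre = proj₁ (proj₂ (proj₂ (greedy G (classAt κ))))

    centre-∈ : ∀ u → centre u ∈ centres
    centre-∈ u = proj₁ (proj₂ (proj₂ (proj₂ (greedy G (classAt κ)))) u)

    centre-class : ∀ u → classAt κ u ≤ classAt κ (centre u)
    centre-class u = proj₁ (proj₂ (proj₂ (proj₂ (proj₂ (greedy G (classAt κ)))) u))

    centre-⇝ : ∀ u → u ⇝ centre u
    centre-⇝ u = proj₂ (proj₂ (proj₂ (proj₂ (proj₂ (greedy G (classAt κ)))) u))

    ∣centres∣≤α : ∣ centres ∣ ≤ α G
    ∣centres∣≤α = proj₂ (proj₂ independenceNumber) centres (proj₁ (proj₂ (greedy G (classAt κ))))

    starTotals : Vec ℕ order → Vec ℕ order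
    starTotals f = tabulate (push centre (lookup f))

    sum-starTotals : ∀ f → Vec.sum (starTotals f) ≡ Vec.sum f
    sum-starTotals f = begin-equality
      Vec.sum (starTotals f)       ≡⟨ sum-tabulate (push centre (lookup f)) ⟩
      sum (push centre (lookup f)) ≡⟨ sum-push centre (lookup f) ⟩
      sum (lookup f)               ≡⟨ sum-tabulate (lookup f) ⟨
      Vec.sum (tabulate (lookup f)) ≡⟨ cong Vec.sum (Vec.tabulate∘lookup f) ⟩
      Vec.sum f                    ∎

    starTotals-supported : ∀ f → Supported centres (starTotals f)
    starTotals-supported f i i∉ = trans (Vec.lookup∘tabulate (push centre (lookup f)) i)
      (push-outside centre (lookup f) i λ j c≡i → i∉ (subst (_∈ centres) c≡i (centre-∈ j)))

    squeezedTotals : Configuration order k → Configuration (α G) k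
    squeezedTotals (f , sum≡k) = squeeze centres (α G) ∣centres∣≤α (starTotals f) ,
      trans (sum-squeeze centres (α G) ∣centres∣≤α (starTotals f) (starTotals-supported f))
        (trans (sum-starTotals f) sum≡k)

    squeezedTotals-injective : ∀ f g → squeezedTotals f ≡ squeezedTotals g →
                               push centre (lookup (proj₁ f)) ≗ push centre (lookup (proj₁ g))
    squeezedTotals-injective (f , _) (g , _) eq i = begin-equality
      push centre (lookup f) i     ≡⟨ Vec.lookup∘tabulate (push centre (lookup f)) i ⟨
      lookup (starTotals f) i      ≡⟨ cong (λ xs → lookup xs i)
        (squeeze-injective centres (α G) ∣centres∣≤α (starTotals f) (starTotals g)
          (starTotals-supported f) (starTotals-supported g) (cong proj₁ eq)) ⟩
      lookup (starTotals g) i      ≡⟨ Vec.lookup∘tabulate (push centre (lookup g)) i ⟩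
      push centre (lookup g) i     ∎

  code : Configuration order k → Fin (suc (class k) ^ order * #Configurations (α G) k)
  code f = combine (classify f)
    (Inverse.from (Configuration-numbering (α G) k) (squeezedTotals (classify f) f))

  code-injective : ∀ f g → code f ≡ code g → classify f ≡ classify g ×
                   squeezedTotals (classify f) f ≡ squeezedTotals (classify f) g
  code-injective f g eq = proj₁ both ,
    trans (from-injective (proj₂ both)) (cong (λ κ → squeezedTotals κ g) (sym (proj₁ both)))
    where
    both = Fin.combine-injective (classify f) _ (classify g) _ eq
    module # = Inverse (Configuration-numbering (α G) k)
    from-injective : ∀ {s t} → #.from s ≡ #.from t → s ≡ t
    from-injective {s} {t} e = trans (sym (#.strictlyInverseˡ s)) (trans (cong #.to e) (#.strictlyInverseˡ t))

  -- Within a class, values differ by at most 1/(order + 1) of the value at any centre of the star,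
  -- so the centre holds enough pebbles to serve all of its star at once.
  code-clique : ∀ f g → code f ≡ code g → Pebbles.Move G k f g
  code-clique f@(xs , sum≡k) g@(ys , _) eq = let coupled p q s = coupling in _ , _ , p , q , s
    where
    κ = classify f
    c = centre κ
    n = order

    sum-lookup : sum (lookup xs) ≡ k
    sum-lookup = trans (sym (sum-tabulate (lookup xs))) (trans (cong Vec.sum (Vec.tabulate∘lookup xs)) sum≡k)

    same-class : ∀ i → class (lookup xs i) ≡ class (lookup ys i)
    same-class i = trans (sym (classAt-classify f i))
      (trans (cong (λ κ → classAt κ i) (proj₁ (code-injective f g eq))) (classAt-classify g i))

    deficit : ∀ u v → c v ≡ u → suc n * (lookup ys v ∸ lookup xs v) ≤ lookup xs u
    deficit u v refl = class-short (lookup ys v) (lookup xs v) (lookup xs (c v)) (sym (same-class v)) (begin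
      class (lookup ys v)      ≡⟨ same-class v ⟨
      class (lookup xs v)      ≡⟨ classAt-classify f v ⟨
      classAt κ v              ≤⟨ centre-class κ v ⟩
      classAt κ (c v)          ≡⟨ classAt-classify f (c v) ⟩
      class (lookup xs (c v))  ∎)

    enough : ∀ u → (lookup xs u ∸ lookup ys u) + push c (λ v → lookup ys v ∸ lookup xs v) u ≤ lookup xs u
    enough u = *-cancelˡ-≤ (suc n) (begin
      suc n * (x + y)                        ≡⟨ *-distribˡ-+ (suc n) x y ⟩
      suc n * x + suc n * y
        ≤⟨ +-mono-≤ (class-short (lookup xs u) (lookup ys u) (lookup xs u) (same-class u) ≤-refl)
                    (push-bound (suc n) (lookup xs u) c (λ v → lookup ys v ∸ lookup xs v) u (deficit u)) ⟩
      suc n * lookup xs u                    ∎)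
      where
      x = lookup xs u ∸ lookup ys u
      y = push c (λ v → lookup ys v ∸ lookup xs v) u

    coupling : Coupled k (lookup xs) (lookup ys)
    coupling = Coupled-size sum-lookup (star-coupling (lookup xs) (lookup ys) c (centre-⇝ κ) enough
      (squeezedTotals-injective κ f g (proj₂ (code-injective f g eq))))

  α[G[k]]-upper : α (G [ k ]) ≤ suc (class k) ^ order * #Configurations (α G) k
  α[G[k]]-upper = clique-cover (G [ k ]) code λ f g eq f≢g → f≢g , code-clique f g eq

-- Polynomial growth

^-distribʳ-* : ∀ o m n → (m * n) ^ o ≡ m ^ o * n ^ o
^-distribʳ-* zero    m n = refl
^-distribʳ-* (suc o) m n = trans (cong (m * n *_) (^-distribʳ-* o m n)) (*-interchange m n (m ^ o) (n ^ o))
  where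
  *-interchange : ∀ a b c d → a * b * (c * d) ≡ a * c * (b * d)
  *-interchange = solve-∀

α-positive : ∀ G → FiniteGraph.Vertex G → ∃ λ p → α G ≡ suc p
α-positive G v = pred (α G) , sym (suc-pred (α G) {{>-nonZero 0<α}})
  where
  0<α = nonadjacent-family G {1} (λ _ → v) (λ { {zero} {zero} _ → refl })
                           (λ _ _ → FiniteGraph.Adj-irrefl G)

module Growth (G : FiniteGraph) (p : ℕ) (α≡1+p : α G ≡ suc p) where
  -- The constant `(p !) ^ e` from the count of configurations is absorbed by the extra factor `k`
  -- as soon as `k` reaches it.
  growth-lower : ∀ e → ∃ λ K → ∀ k → K ≤ k → k ^ (p * e) ≤ α (G [ k ]) ^ e * k
  growth-lower e = (p !) ^ e , λ k K≤k → let A = α (G [ k ]) in begin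
    k ^ (p * e)        ≡⟨ ^-*-assoc k p e ⟨
    (k ^ p) ^ e        ≤⟨ ^-monoˡ-≤ e (≤-trans (#Configurations-lower p k) (*-monoʳ-≤ (p !)
                            (subst (λ a → #Configurations a k ≤ A) α≡1+p (α[G[k]]-lower G k)))) ⟩
    (p ! * A) ^ e      ≡⟨ ^-distribʳ-* e (p !) A ⟩
    (p !) ^ e * A ^ e    ≤⟨ *-monoˡ-≤ (A ^ e) K≤k ⟩
    k * A ^ e          ≡⟨ *-comm k (A ^ e) ⟩
    A ^ e * k          ∎

  -- The exponent `p * e` comes from the star totals. One more factor comes from the
  -- classifications, whose e-th power is at most c · (k+1), and the last absorbs `c` and the powers
  -- of 2 from k+1 ≤ 2k.
  growth-upper : ∀ e → ∃ λ K → ∀ k → K ≤ k → 1 ≤ k → α (G [ k ]) ^ e ≤ k ^ (2 + p * e)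
  growth-upper e =
    let c , bound = class-subpolynomial (order * e)
    in c * 2 ^ suc (p * e) , λ k K≤k 1≤k →
    let A = α (G [ k ]) ; C = suc (class k) in begin
    A ^ e
      ≤⟨ ^-monoˡ-≤ e (CliqueCover.α[G[k]]-upper G k) ⟩
    (C ^ order * #Configurations (α G) k) ^ e
      ≡⟨ ^-distribʳ-* e (C ^ order) _ ⟩
    (C ^ order) ^ e * #Configurations (α G) k ^ e
      ≤⟨ *-mono-≤ (≤-trans (≤-reflexive (^-*-assoc C order e)) (bound k))
           (^-monoˡ-≤ e (subst (λ a → #Configurations a k ≤ suc k ^ p) (sym α≡1+p) (#Configurations-upper p k))) ⟩
    c * suc k * (suc k ^ p) ^ e
      ≡⟨ trans (cong (c * suc k *_) (^-*-assoc (suc k) p e)) (*-assoc c (suc k) _) ⟩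
    c * suc k ^ suc (p * e)
      ≤⟨ *-monoʳ-≤ c (^-monoˡ-≤ (suc (p * e)) (+-mono-≤ 1≤k (≤-reflexive (sym (+-identityʳ k))))) ⟩
    c * (2 * k) ^ suc (p * e)
      ≡⟨ trans (cong (c *_) (^-distribʳ-* (suc (p * e)) 2 k)) (sym (*-assoc c _ _)) ⟩
    c * 2 ^ suc (p * e) * k ^ suc (p * e)
      ≤⟨ *-monoˡ-≤ (k ^ suc (p * e)) K≤k ⟩
    k ^ (2 + p * e) ∎
    where
    open FiniteGraph G using (order)
    open Classes (suc order) using (class; class-subpolynomial)

mainTheorem1 : (G : FiniteGraph) → FiniteGraph.Vertex G →
    Limit (λ k → log (α (G [ k ])) /ℝ log k) (fromℕ (α G) -ℝ 1ℝ)
mainTheorem1 G v ε (mk< δ 0<δ M below) =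
  let p , α≡1+p = α-positive G v
      K , J , bound = LogGrowth.polynomial-growth (λ k → α (G [ k ])) p α≡1+p
        (Growth.growth-lower G p α≡1+p) (Growth.growth-upper G p α≡1+p) δ 0<δ
  in K , λ k K≤k →
    -- From `M` on the approximations of `ε` are at least `δ`, and from `J` on those of the distance
    -- plus this gap are at most `δ`.
    mk< (ℚ.½ ℚ.* δ) (RationalLemmas.half-pos 0<δ) (M ⊔ J) λ j l →
      ℚ.≤-trans (bound k K≤k (nonTrivial⇒n>1 k) j (m⊔n≤o⇒n≤o M J l))
        (subst (ℚ._≤ ℝ.seq ε j) (ℚ.+-identityˡ δ) (below j (m⊔n≤o⇒m≤o M J l)))
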